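{- Let $p\in(0,1)$, $v\in(0,1)$, $a>1$ and $b\in[0,1]$. Consider the agent that starts at the origin $0$ of the real line at time $0$ and, for rounds $i=0,1,2,\dots$ until the target is found, performs in round $i$ the following moves: (1) it moves from $0$ to $(-1)^{i+1}a^{i-2}$ at speed $1$; (2) it moves from there to $(-1)^{i+1}a^{i}$ at speed $v$; (3) it moves from there to $(-1)^{i+1}\left(a^{i}+b(a^{i+2}-a^{i})\right)$ at speed $1$; (4) it moves back to $0$ at speed $1$. The expected competitive ratio of this algorithm with expansion ratio $a$ and scout-ahead ratio $b$ is $\max\{CR_1,CR_2\}$, where $$CR_1=\frac{1}{(a^2-1)b+1}\left[\frac{(a^2-1)b}{v}+\frac{a^2\left(a^2\left(2(a^2-1)bv+v+1\right)+v-1\right)}{(a-1)a^2v}+1\right]$$ and $$CR_2=(a+1)\left[2a^2b(p-1)^2+a\left(\frac{1}{a-1}-2b(p-1)p\right)+\frac{(p-2)p(v-1)}{av}+p(2b+p-2)+\frac{(p-1)^2}{v}\right].$$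
   Context: Search model (linear search, or cow-path, with probabilistic detection and two speeds): a stationary target is located at an unknown position $x$ on the infinite real line. The agent can move at speed $1$ or at the slower speed $v$. When it passes through the target's location while moving at speed $v$, it is guaranteed to detect the target. Each time it passes through the target's location while moving at speed $1$, it detects the target with probability $p$, independently of other passes. The search ends at the first detection. The competitive ratio is the worst case, over the unknown target position $x$, of the ratio of the agent's total travel time until detection to the minimum possible time $|x|$ required by an omniscient agent (which moves directly to the target at speed $1$); the expected competitive ratio is this worst case with the agent's travel time replaced by its expectation over the random detections.
   Formalization: The worst case is taken over targets x ≤ −1 or x ≥ a only: over all x the ratio is unbounded as x → 0, and over |x| ≥ 1 the formula can fail (e.g. x=1, a=10, b=1, p=0.999, v=0.001). -}

module Defs where

open import Algebra.Bundles using (CommutativeRing)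
open import Data.List.Base using (List; []; _∷_; foldl)
open import Data.Nat.Base as ℕ using (ℕ; zero; suc)
open import Data.Product.Base using (∃; ∃-syntax; _×_; _,_)
open import Data.Sum.Base using (_⊎_)
open import Level using () renaming (_⊔_ to _⊔ℓ_; suc to sucℓ)
open import Relation.Binary.Bundles using (DecTotalOrder; StrictTotalOrder)
open import Relation.Binary.Core using (Rel)
open import Relation.Binary.Structures using (IsDecTotalOrder)
open import Relation.Nullary using (¬_; Dec; yes; no)
open import Relation.Nullary.Decidable using (_×-dec_; _⊎-dec_)
open import Relation.Unary using (Pred; Satisfiable)
import Algebra.Construct.NaturalChoice.Max as Max
import Algebra.Properties.Semiring.Exp as Exp
import Relation.Binary.Properties.DecTotalOrder as DecTotalOrderProperties

-- The classical real numbers, as a complete ordered field.  The Archimedean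
-- property is not a field, because it follows from completeness.

record RealNumbers c ℓ₁ ℓ₂ : Set (sucℓ (c ⊔ℓ ℓ₁ ⊔ℓ ℓ₂)) where
  infix  4 _≤_ _⟶_
  infix  9 _⁻¹
  infixl 7 _/_

  field
    commutativeRing : CommutativeRing c ℓ₁

  open CommutativeRing commutativeRing public
  open Exp semiring public using (_^_)

  field
    _⁻¹         : Carrier → Carrier
    ⁻¹-cong     : ∀ {x y} → x ≈ y → x ⁻¹ ≈ y ⁻¹
    -- 0# ⁻¹ is an unspecified junk value.
    ⁻¹-inverseʳ : ∀ {x} → ¬ (x ≈ 0#) → x * x ⁻¹ ≈ 1#
    0≉1         : ¬ (0# ≈ 1#)

    _≤_             : Rel Carrier ℓ₂
    isDecTotalOrder : IsDecTotalOrder _≈_ _≤_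
    +-monoˡ-≤       : ∀ z {x y} → x ≤ y → x + z ≤ y + z
    *-nonNegative   : ∀ {x y} → 0# ≤ x → 0# ≤ y → 0# ≤ x * y

  decTotalOrder : DecTotalOrder c ℓ₁ ℓ₂
  decTotalOrder = record { isDecTotalOrder = isDecTotalOrder }

  open DecTotalOrder decTotalOrder public using (totalOrder; _≤?_)
  open DecTotalOrderProperties decTotalOrder public
    using (_<_; <-strictTotalOrder)
  open StrictTotalOrder <-strictTotalOrder public using (_<?_)
  open Max totalOrder public using (_⊔_)

  _/_ : Carrier → Carrier → Carrier
  x / y = x * y ⁻¹

  ∣_∣ : Carrier → Carrier
  ∣ x ∣ = x ⊔ (- x)

  2# : Carrier
  2# = 1# + 1#

  UpperBound : ∀ {ℓ} → Pred Carrier ℓ → Pred Carrier (c ⊔ℓ ℓ₂ ⊔ℓ ℓ)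
  UpperBound P u = ∀ x → P x → x ≤ u

  -- Leastness says that every y below s is exceeded by an element of P; this
  -- is the constructively informative form of "no y < s is an upper bound".
  IsSup : ∀ {ℓ} → Pred Carrier ℓ → Pred Carrier (c ⊔ℓ ℓ₁ ⊔ℓ ℓ₂ ⊔ℓ ℓ)
  IsSup P s = UpperBound P s × (∀ y → y < s → ∃[ x ] (P x × y < x))

  field
    complete : (P : Pred Carrier (c ⊔ℓ ℓ₁ ⊔ℓ ℓ₂)) →
               Satisfiable P → ∃ (UpperBound P) → ∃ (IsSup P)

  _⟶_ : (ℕ → Carrier) → Carrier → Set (c ⊔ℓ ℓ₁ ⊔ℓ ℓ₂)
  f ⟶ l = ∀ ε → 0# < ε → ∃[ N ] (∀ n → N ℕ.≤ n → ∣ f n - l ∣ < ε)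

module Search {c ℓ₁ ℓ₂} (ℝ : RealNumbers c ℓ₁ ℓ₂)
              (p v : RealNumbers.Carrier ℝ) where

  open RealNumbers ℝ

  infix 4 _at_

  data Mode : Set where
    fast slow : Mode

  speed : Mode → Carrier
  speed fast = 1#
  speed slow = v

  detection : Mode → Carrier
  detection fast = p
  detection slow = 1#

  -- A leg starts wherever the previous one ended.
  record Leg : Set c where
    constructor _at_
    field
      destination : Carrier
      mode        : Mode

  -- The legs performed in each round, in order, while the target is unfound.
  Strategy : Set c
  Strategy = ℕ → List Leg

  -- Legs are half-open, including their destination but not their starting
  -- point, so that a visit to the common endpoint of two consecutive legs
  -- counts as a single pass, made in the mode of the earlier leg.
  Passes : (from to x : Carrier) → Set (ℓ₁ ⊔ℓ ℓ₂)
  Passes from to x = (from < x × x ≤ to) ⊎ (to ≤ x × x < from)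

  passes? : ∀ from to x → Dec (Passes from to x)
  passes? from to x =
    ((from <? x) ×-dec (x ≤? to)) ⊎-dec ((to ≤? x) ×-dec (x <? from))

  -- Position and elapsed time of an agent that has not found the target yet,
  -- the probability of not having found it, and the sum, over the passes made
  -- so far, of  (time of the pass) · P(first detection happens at that pass).
  record State : Set c where
    constructor state
    field
      position   : Carrier
      time       : Carrier
      undetected : Carrier
      partial    : Carrier

  open State public

  initial : State
  initial = state 0# 0# 1# 0#

  -- Detections at different passes are independent: the first detection
  -- happens at a given pass with probability  undetected * detection mode.
  step : Carrier → State → Leg → State
  step x (state pos t u e) (dest at m) with passes? pos dest x
  ... | yes _ = state dest (t + ∣ dest - pos ∣ / speed m)
                  (u * (1# - detection m))
                  (e + u * detection m * (t + ∣ x - pos ∣ / speed m))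
  ... | no  _ = state dest (t + ∣ dest - pos ∣ / speed m) u e

  afterRounds : Strategy → Carrier → ℕ → State
  afterRounds σ x zero    = initial
  afterRounds σ x (suc n) = foldl (step x) (afterRounds σ x n) (σ n)

  -- The expectation is finite only if the target is found almost surely.
  HasExpectedTime : Strategy → Carrier → Carrier → Set (c ⊔ℓ ℓ₁ ⊔ℓ ℓ₂)
  HasExpectedTime σ x E =
    ((λ n → undetected (afterRounds σ x n)) ⟶ 0#) ×
    ((λ n → partial (afterRounds σ x n)) ⟶ E)

  ExpectedRatio : ∀ {ℓ} → Strategy → Pred Carrier ℓ →
                  Pred Carrier (c ⊔ℓ ℓ₁ ⊔ℓ ℓ₂ ⊔ℓ ℓ)
  ExpectedRatio σ X r =
    ∃[ x ] ∃[ E ] (X x × HasExpectedTime σ x E × r ≈ E / ∣ x ∣)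

  -- The worst case over targets x ∈ X.  The first component asserts that all
  -- expected times are finite: an infinite one would leave no trace in
  -- ExpectedRatio.
  IsExpectedCompetitiveRatio : ∀ {ℓ} → Strategy → Pred Carrier ℓ →
                               Pred Carrier (c ⊔ℓ ℓ₁ ⊔ℓ ℓ₂ ⊔ℓ ℓ)
  IsExpectedCompetitiveRatio σ X ρ =
    (∀ x → X x → ∃ (HasExpectedTime σ x)) × IsSup (ExpectedRatio σ X) ρ

  algorithm : (a b : Carrier) → Strategy
  algorithm a b i =
      (side * (a ^ i / a ^ 2)                      at fast)
    ∷ (side * a ^ i                                at slow)
    ∷ (side * (a ^ i + b * (a ^ (i ℕ.+ 2) - a ^ i)) at fast)
    ∷ (0#                                          at fast)
    ∷ []
    where side = (- 1#) ^ (i ℕ.+ 1)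

  -- Targets strictly between -1 and a, the far ends of the slow legs of rounds
  -- 0 and 1, are left out.  Some cut-off is unavoidable, since the ratio is
  -- unbounded as x → 0; and ∣x∣ ≥ 1 would not do, because a target 1 ≤ x < a
  -- was not exposed to the scouting of any earlier round, and its ratio can
  -- exceed CR₁ a b ⊔ CR₂ a b, for instance when x = 1, a = 10, b = 1,
  -- p = 0.999 and v = 0.001.
  BeyondStart : Carrier → Pred Carrier ℓ₂
  BeyondStart a x = (x ≤ - 1#) ⊎ (a ≤ x)

  CR₁ : (a b : Carrier) → Carrier
  CR₁ a b =
    (1# / ((a ^ 2 - 1#) * b + 1#)) *
    ( ((a ^ 2 - 1#) * b) / v
    + (a ^ 2 * (a ^ 2 * (2# * (a ^ 2 - 1#) * b * v + v + 1#) + v - 1#))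
        / ((a - 1#) * a ^ 2 * v)
    + 1# )

  CR₂ : (a b : Carrier) → Carrier
  CR₂ a b =
    (a + 1#) *
    ( 2# * a ^ 2 * b * (p - 1#) ^ 2
    + a * (1# / (a - 1#) - 2# * b * (p - 1#) * p)
    + ((p - 2#) * p * (v - 1#)) / (a * v)
    + p * (2# * b + p - 2#)
    + (p - 1#) ^ 2 / v )

{-# OPTIONS --safe #-}
module Submission where

-- A target at distance d in (a^j, a^(j+2)] on the side of round j is surely found
-- by the slow leg of round j + 2.  No earlier round passes it except round j,
-- whose scouting passes it twice, once or never according as d < S, d = S or
-- d > S, where S = w a^j is the far end of the round.  If d ≠ S, the expected time
-- is F a^j + G d - c, where F ≥ 0 and c ≥ 0, and F, G and c do not depend on j and
-- d.  Thus the ratio is at most its value for c = 0 at the left end of the range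
-- of d, and approaches it there as j → ∞: this gives CR₂ at d = a^j and CR₁ at
-- d = S.  A target with d = S costs no more than the slow leg alone, hence at most
-- CR₁, and the targets -1 and a, which no earlier round scouts, cost at most CR₂.
-- If b = 0 or b = 1, one of the two ranges is empty, but then its value is at most
-- the other one.

open import Algebra.Bundles using (CommutativeRing)
open import Algebra.Solver.Ring.AlmostCommutativeRing
  using (AlmostCommutativeRing; fromCommutativeRing; _-Raw-AlmostCommutative⟶_)
open import Data.Empty using (⊥-elim)
open import Data.Integer.Base as ℤ using (ℤ; +_; -[1+_])
open import Data.List.Base using ([]; _∷_; foldl)
open import Data.Maybe.Base as Maybe using (Maybe)
open import Data.Nat.Base as ℕ using (ℕ; zero; suc)
open import Data.Product.Base using (∃; ∃-syntax; _×_; _,_; proj₁; proj₂)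
open import Data.Sum.Base using (_⊎_; inj₁; inj₂)
open import Level using (Lift; lift) renaming (_⊔_ to _⊔ℓ_)
open import Relation.Binary.Bundles using (DecTotalOrder)
open import Relation.Binary.PropositionalEquality.Core as ≡ using (_≡_)
open import Relation.Nullary using (¬_; yes; no)
open import Relation.Nullary.Decidable using (dec⇒maybe)
import Algebra.Construct.NaturalChoice.Max as Max
import Algebra.Properties.Ring as RingProperties
import Algebra.Properties.Semiring.Exp as Exp
import Algebra.Properties.Semiring.Mult.TCOptimised as Mult
import Algebra.Solver.Ring as RingSolver
import Data.Integer.Properties as ℤ
import Data.Nat.Properties as ℕ
import Data.Sign.Base as Sign
import Relation.Binary.Properties.DecTotalOrder as DecTotalOrderProperties
import Relation.Binary.Reasoning.Setoid as SetoidReasoning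

open import Defs

-- Ring solver with integer coefficients.

module IntegerSolver {c ℓ} (R : CommutativeRing c ℓ) where

  open CommutativeRing R
  open RingProperties ring
  open Mult semiring using (1+×; ×-homo-+; ×1-homo-*) renaming (_×_ to _·_)
  open SetoidReasoning setoid

  -- Integers serve as coefficients because their equality computes. With the optimised multiple, 0,
  -- 1 and 2 denote `0#`, `1#` and `2#` definitionally, so solved equations match goals written with
  -- these constants.
  ⟦_⟧ : ℤ → Carrier
  ⟦ + n      ⟧ = n · 1#
  ⟦ -[1+ n ] ⟧ = - (suc n · 1#)

  ⊖-homo : ∀ m n → ⟦ m ℤ.⊖ n ⟧ ≈ m · 1# - n · 1#
  ⊖-homo zero    zero    = sym (-‿inverseʳ 0#)
  ⊖-homo (suc m) zero    = sym (trans (+-congˡ -0#≈0#) (+-identityʳ _))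
  ⊖-homo zero    (suc n) = sym (+-identityˡ _)
  ⊖-homo (suc m) (suc n) = begin
    ⟦ suc m ℤ.⊖ suc n ⟧                     ≡⟨ ≡.cong ⟦_⟧ (ℤ.[1+m]⊖[1+n]≡m⊖n m n) ⟩
    ⟦ m ℤ.⊖ n ⟧                             ≈⟨ ⊖-homo m n ⟩
    m · 1# - n · 1#                         ≈⟨ +-congʳ (+-identityʳ _) ⟨
    (m · 1# + 0#) - n · 1#                  ≈⟨ +-congʳ (+-congˡ (-‿inverseʳ 1#)) ⟨
    (m · 1# + (1# - 1#)) - n · 1#           ≈⟨ +-congʳ (+-assoc _ _ _) ⟨
    ((m · 1# + 1#) - 1#) - n · 1#           ≈⟨ +-assoc _ _ _ ⟩
    (m · 1# + 1#) + (- 1# - n · 1#)         ≈⟨ +-cong (+-comm _ _) (-‿+-comm 1# (n · 1#)) ⟩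
    (1# + m · 1#) - (1# + n · 1#)           ≈⟨ +-cong (1+× m 1#) (-‿cong (1+× n 1#)) ⟨
    suc m · 1# - suc n · 1#                 ∎

  +-homo : ∀ i j → ⟦ i ℤ.+ j ⟧ ≈ ⟦ i ⟧ + ⟦ j ⟧
  +-homo (+ m)      (+ n)      = ×-homo-+ 1# m n
  +-homo (+ m)      (-[1+ n ]) = ⊖-homo m (suc n)
  +-homo (-[1+ m ]) (+ n)      = trans (⊖-homo n (suc m)) (+-comm _ _)
  +-homo (-[1+ m ]) (-[1+ n ]) = begin
    - (suc (suc (m ℕ.+ n)) · 1#)     ≡⟨ ≡.cong (λ k → - (suc k · 1#)) (ℕ.+-suc m n) ⟨
    - ((suc m ℕ.+ suc n) · 1#)       ≈⟨ -‿cong (×-homo-+ 1# (suc m) (suc n)) ⟩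
    - (suc m · 1# + suc n · 1#)      ≈⟨ -‿+-comm _ _ ⟨
    - (suc m · 1#) - suc n · 1#      ∎

  -‿homo : ∀ i → ⟦ ℤ.- i ⟧ ≈ - ⟦ i ⟧
  -‿homo (+ zero)   = sym -0#≈0#
  -‿homo (+ suc n)  = refl
  -‿homo (-[1+ n ]) = sym (-‿involutive _)

  -◃-homo : ∀ n → ⟦ Sign.- ℤ.◃ n ⟧ ≈ - (n · 1#)
  -◃-homo zero    = sym -0#≈0#
  -◃-homo (suc n) = refl

  +◃-homo : ∀ n → ⟦ Sign.+ ℤ.◃ n ⟧ ≈ n · 1#
  +◃-homo zero    = refl
  +◃-homo (suc n) = refl

  *-homo : ∀ i j → ⟦ i ℤ.* j ⟧ ≈ ⟦ i ⟧ * ⟦ j ⟧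
  *-homo (+ m)      (+ n)      = trans (+◃-homo (m ℕ.* n)) (×1-homo-* m n)
  *-homo (+ m)      (-[1+ n ]) = trans (-◃-homo (m ℕ.* suc n))
    (trans (-‿cong (×1-homo-* m (suc n))) (-‿distribʳ-* _ _))
  *-homo (-[1+ m ]) (+ n)      = trans (-◃-homo (suc m ℕ.* n))
    (trans (-‿cong (×1-homo-* (suc m) n)) (-‿distribˡ-* _ _))
  *-homo (-[1+ m ]) (-[1+ n ]) = begin
    (suc m ℕ.* suc n) · 1#              ≈⟨ ×1-homo-* (suc m) (suc n) ⟩
    (suc m · 1#) * (suc n · 1#)         ≈⟨ -‿involutive _ ⟨
    - - ((suc m · 1#) * (suc n · 1#))   ≈⟨ -‿cong (-‿distribˡ-* _ _) ⟩
    - (- (suc m · 1#) * (suc n · 1#))   ≈⟨ -‿distribʳ-* _ _ ⟩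
    - (suc m · 1#) * - (suc n · 1#)     ∎

  almostCommutativeRing : AlmostCommutativeRing c ℓ
  almostCommutativeRing = fromCommutativeRing R

  ℤ⟶R : ℤ.+-*-rawRing -Raw-AlmostCommutative⟶ almostCommutativeRing
  ℤ⟶R = record
    { ⟦_⟧ = ⟦_⟧ ; +-homo = +-homo ; *-homo = *-homo ; -‿homo = -‿homo
    ; 0-homo = refl ; 1-homo = refl }

  _≟_ : ∀ i j → Maybe (⟦ i ⟧ ≈ ⟦ j ⟧)
  i ≟ j = Maybe.map (λ i≡j → reflexive (≡.cong ⟦_⟧ i≡j)) (dec⇒maybe (i ℤ.≟ j))

  open RingSolver ℤ.+-*-rawRing almostCommutativeRing ℤ⟶R _≟_ public
    using (Polynomial; con; _:+_; _:*_; _:-_; :-_; _:^_; _:=_; solve)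

-- Arithmetic of the ordered field and absolute values.

module RealProperties {c ℓ₁ ℓ₂} (ℝ : RealNumbers c ℓ₁ ℓ₂) where

  open RealNumbers ℝ public
  open DecTotalOrder decTotalOrder public
    using (total; antisym; ≤-respˡ-≈; ≤-respʳ-≈)
    renaming (refl to ≤-refl; reflexive to ≤-reflexive; trans to ≤-trans)
  open DecTotalOrderProperties decTotalOrder public
    using (<-trans; <-irrefl; <-respˡ-≈; <-respʳ-≈; <⇒≱; ≰⇒>; ≮⇒≥)
  open Max totalOrder public
    using (x≤y⇒x⊔y≈y; x≤y⇒y⊔x≈y; x≤x⊔y; x≤y⊔x; ⊔-cong)
  open IntegerSolver commutativeRing public
    using (Polynomial; con; _:+_; _:*_; _:-_; :-_; _:^_; _:=_; solve)

  𝟘 𝟙 𝟚 : ∀ {n} → Polynomial n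
  𝟘 = con (+ 0)
  𝟙 = con (+ 1)
  𝟚 = con (+ 2)

  <⇒≤ : ∀ {x y} → x < y → x ≤ y
  <⇒≤ = proj₁

  <⇒≉ : ∀ {x y} → x < y → ¬ (y ≈ x)
  <⇒≉ x<y y≈x = proj₂ x<y (sym y≈x)

  <-≤-trans : ∀ {x y z} → x < y → y ≤ z → x < z
  <-≤-trans (x≤y , x≉y) y≤z =
    ≤-trans x≤y y≤z , λ x≈z → x≉y (antisym x≤y (≤-respʳ-≈ (sym x≈z) y≤z))

  ≤-<-trans : ∀ {x y z} → x ≤ y → y < z → x < z
  ≤-<-trans x≤y (y≤z , y≉z) =
    ≤-trans x≤y y≤z , λ x≈z → y≉z (antisym y≤z (≤-respˡ-≈ x≈z x≤y))

  ≤⇒0≤ : ∀ {x y} → x ≤ y → 0# ≤ y - x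
  ≤⇒0≤ {x} x≤y = ≤-respˡ-≈ (-‿inverseʳ x) (+-monoˡ-≤ (- x) x≤y)

  <⇒0< : ∀ {x y} → x < y → 0# < y - x
  <⇒0< {x} {y} (x≤y , x≉y) = ≤⇒0≤ x≤y , λ 0≈y-x → x≉y (begin
    x              ≈⟨ +-identityˡ x ⟨
    0# + x         ≈⟨ +-congʳ 0≈y-x ⟩
    (y - x) + x    ≈⟨ solve 2 (λ x y → (y :- x) :+ x := y) refl x y ⟩
    y              ∎)
    where open SetoidReasoning setoid

  -- The standard way to prove an inequality below: exhibit the difference as a visibly nonnegative
  -- term and leave the equation to the solver.
  ≤-by : ∀ {x y z} → 0# ≤ z → y ≈ x + z → x ≤ y
  ≤-by {x} 0≤z y≈x+z = ≤-respˡ-≈ (+-identityˡ x)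
    (≤-respʳ-≈ (trans (+-comm _ x) (sym y≈x+z)) (+-monoˡ-≤ x 0≤z))

  <-by : ∀ {x y z} → 0# < z → y ≈ x + z → x < y
  <-by {x} {y} {z} (0≤z , 0≉z) y≈x+z = ≤-by 0≤z y≈x+z , λ x≈y → 0≉z (begin
    0#             ≈⟨ -‿inverseˡ x ⟨
    - x + x        ≈⟨ +-congˡ (trans x≈y y≈x+z) ⟩
    - x + (x + z)  ≈⟨ solve 2 (λ x z → :- x :+ (x :+ z) := z) refl x z ⟩
    z              ∎)
    where open SetoidReasoning setoid

  0≤-+ : ∀ {x y} → 0# ≤ x → 0# ≤ y → 0# ≤ x + y
  0≤-+ {x} {y} 0≤x 0≤y = ≤-trans 0≤x (≤-by 0≤y refl)

  0<-+ : ∀ {x y} → 0# < x → 0# ≤ y → 0# < x + y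
  0<-+ {x} {y} 0<x 0≤y = <-≤-trans 0<x (≤-by 0≤y refl)

  -- If `1# ≤ 0#`, then `0# - 1#` is nonnegative, and so is its square, which is `1#`.
  0≤1 : 0# ≤ 1#
  0≤1 with total 0# 1#
  ... | inj₁ 0≤1 = 0≤1
  ... | inj₂ 1≤0 = ≤-respʳ-≈ (solve 0 ((𝟘 :- 𝟙) :* (𝟘 :- 𝟙) := 𝟙) refl)
                     (*-nonNegative (≤⇒0≤ 1≤0) (≤⇒0≤ 1≤0))

  0<1 : 0# < 1#
  0<1 = 0≤1 , 0≉1

  0<-* : ∀ {x y} → 0# < x → 0# < y → 0# < x * y
  0<-* {x} {y} (0≤x , 0≉x) (0≤y , 0≉y) = *-nonNegative 0≤x 0≤y , λ 0≈xy → 0≉y (begin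
    0#                ≈⟨ zeroʳ (x ⁻¹) ⟨
    x ⁻¹ * 0#         ≈⟨ *-congˡ 0≈xy ⟩
    x ⁻¹ * (x * y)    ≈⟨ solve 3 (λ x y z → z :* (x :* y) := (x :* z) :* y) refl x y (x ⁻¹) ⟩
    (x * x ⁻¹) * y    ≈⟨ *-congʳ (⁻¹-inverseʳ (λ x≈0 → 0≉x (sym x≈0))) ⟩
    1# * y            ≈⟨ *-identityˡ y ⟩
    y                 ∎)
    where open SetoidReasoning setoid

  0≤-2* : ∀ {x} → 0# ≤ x → 0# ≤ 2# * x
  0≤-2* = *-nonNegative (0≤-+ 0≤1 0≤1)

  *-inverse : ∀ {x} → 0# < x → x * x ⁻¹ ≈ 1#
  *-inverse 0<x = ⁻¹-inverseʳ (<⇒≉ 0<x)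

  ⁻¹-unique : ∀ {x y} → 0# < x → x * y ≈ 1# → x ⁻¹ ≈ y
  ⁻¹-unique {x} {y} 0<x xy≈1 = begin
    x ⁻¹              ≈⟨ *-identityʳ _ ⟨
    x ⁻¹ * 1#         ≈⟨ *-congˡ xy≈1 ⟨
    x ⁻¹ * (x * y)    ≈⟨ solve 3 (λ x y z → z :* (x :* y) := (x :* z) :* y) refl x y (x ⁻¹) ⟩
    (x * x ⁻¹) * y    ≈⟨ *-congʳ (*-inverse 0<x) ⟩
    1# * y            ≈⟨ *-identityˡ y ⟩
    y                 ∎
    where open SetoidReasoning setoid

  -- If `x ⁻¹` were at most `0#`, then `x * (0# - x ⁻¹)`, which is minus one, would be nonnegative.
  0<-⁻¹ : ∀ {x} → 0# < x → 0# < x ⁻¹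
  0<-⁻¹ {x} 0<x = ≰⇒> λ x⁻¹≤0 →
    <⇒≱ 0<1 (≤-by (*-nonNegative (<⇒≤ 0<x) (≤⇒0≤ x⁻¹≤0)) (begin
      0#                           ≈⟨ -‿inverseʳ 1# ⟨
      1# - 1#                      ≈⟨ +-congˡ (-‿cong (*-inverse 0<x)) ⟨
      1# - x * x ⁻¹                ≈⟨ solve 2 (λ x z → 𝟙 :- x :* z := 𝟙 :+ x :* (𝟘 :- z)) refl x (x ⁻¹) ⟩
      1# + x * (0# - x ⁻¹)         ∎))
    where open SetoidReasoning setoid

  /-≤ : ∀ {x y z} → 0# < y → x ≤ z * y → x / y ≤ z
  /-≤ {x} {y} {z} 0<y x≤zy = ≤-by (*-nonNegative (≤⇒0≤ x≤zy) (<⇒≤ (0<-⁻¹ 0<y))) (begin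
    z                                     ≈⟨ *-identityʳ z ⟨
    z * 1#                                ≈⟨ *-congˡ (*-inverse 0<y) ⟨
    z * (y * y ⁻¹)                        ≈⟨ solve 4 (λ x y z u → z :* (y :* u) := x :* u :+ (z :* y :- x) :* u) refl x y z (y ⁻¹) ⟩
    x * y ⁻¹ + (z * y - x) * y ⁻¹         ∎)
    where open SetoidReasoning setoid

  ≤-/ : ∀ {x y z} → 0# < y → z * y ≤ x → z ≤ x / y
  ≤-/ {x} {y} {z} 0<y zy≤x = ≤-by (*-nonNegative (≤⇒0≤ zy≤x) (<⇒≤ (0<-⁻¹ 0<y))) (begin
    x * y ⁻¹                              ≈⟨ solve 4 (λ x y z u → x :* u := z :* (y :* u) :+ (x :- z :* y) :* u) refl x y z (y ⁻¹) ⟩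
    z * (y * y ⁻¹) + (x - z * y) * y ⁻¹   ≈⟨ +-congʳ (trans (*-congˡ (*-inverse 0<y)) (*-identityʳ z)) ⟩
    z + (x - z * y) * y ⁻¹                ∎)
    where open SetoidReasoning setoid

  <-/ : ∀ {x y z} → 0# < y → z * y < x → z < x / y
  <-/ {x} {y} {z} 0<y zy<x = <-by (0<-* (<⇒0< zy<x) (0<-⁻¹ 0<y)) (begin
    x * y ⁻¹                              ≈⟨ solve 4 (λ x y z u → x :* u := z :* (y :* u) :+ (x :- z :* y) :* u) refl x y z (y ⁻¹) ⟩
    z * (y * y ⁻¹) + (x - z * y) * y ⁻¹   ≈⟨ +-congʳ (trans (*-congˡ (*-inverse 0<y)) (*-identityʳ z)) ⟩
    z + (x - z * y) * y ⁻¹                ∎)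
    where open SetoidReasoning setoid

  /-<⁻ : ∀ {x y z} → 0# < y → x / y < z → x < z * y
  /-<⁻ {x} {y} {z} 0<y x/y<z = <-by (0<-* (<⇒0< x/y<z) 0<y) (begin
    z * y                                             ≈⟨ solve 4 (λ x y z u → z :* y := x :+ (z :- x :* u) :* y :+ x :* (y :* u :- 𝟙)) refl x y z (y ⁻¹) ⟩
    x + (z - x * y ⁻¹) * y + x * (y * y ⁻¹ - 1#)      ≈⟨ +-congˡ (*-congˡ (+-congʳ (*-inverse 0<y))) ⟩
    x + (z - x * y ⁻¹) * y + x * (1# - 1#)            ≈⟨ solve 2 (λ x s → s :+ x :* (𝟙 :- 𝟙) := s) refl x _ ⟩
    x + (z - x * y ⁻¹) * y                            ∎)
    where open SetoidReasoning setoid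

  neg-mono-≤ : ∀ {x y} → x ≤ y → - y ≤ - x
  neg-mono-≤ {x} {y} x≤y = ≤-by (≤⇒0≤ x≤y) (solve 2 (λ x y → :- x := :- y :+ (y :- x)) refl x y)

  neg-mono-< : ∀ {x y} → x < y → - y < - x
  neg-mono-< {x} {y} x<y = <-by (<⇒0< x<y) (solve 2 (λ x y → :- x := :- y :+ (y :- x)) refl x y)

  ≤-resp-≈ : ∀ {x x′ y y′} → x ≈ x′ → y ≈ y′ → x ≤ y → x′ ≤ y′
  ≤-resp-≈ x≈x′ y≈y′ x≤y = ≤-respˡ-≈ x≈x′ (≤-respʳ-≈ y≈y′ x≤y)

  <-resp-≈₂ : ∀ {x x′ y y′} → x ≈ x′ → y ≈ y′ → x < y → x′ < y′
  <-resp-≈₂ x≈x′ y≈y′ x<y = <-respˡ-≈ x≈x′ (<-respʳ-≈ y≈y′ x<y)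

  1*-≈ : ∀ {s x} → s ≈ 1# → s * x ≈ x
  1*-≈ s≈1 = trans (*-congʳ s≈1) (*-identityˡ _)

  -1*-≈ : ∀ {s x} → s ≈ - 1# → s * x ≈ - x
  -1*-≈ s≈-1 = trans (*-congʳ s≈-1) (solve 1 (λ x → :- 𝟙 :* x := :- x) refl _)

  vanish : ∀ {x y} k → x ≈ y → k * (x - y) ≈ 0#
  vanish {x} {y} k x≈y = trans (*-congˡ (trans (+-congʳ x≈y) (-‿inverseʳ y))) (zeroʳ k)

  -- The solver knows nothing of inverses. An identity that depends on relations such as
  -- `v * V ≈ 1#` is solved as a polynomial identity with added multiples of `v * V - 1#`, which are
  -- then removed one by one.
  +-vanish : ∀ {x y z} k → x ≈ y → z + k * (x - y) ≈ z
  +-vanish k x≈y = trans (+-congˡ (vanish k x≈y)) (+-identityʳ _)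

  ∣-∣-cong : ∀ {x y} → x ≈ y → ∣ x ∣ ≈ ∣ y ∣
  ∣-∣-cong x≈y = ⊔-cong x≈y (-‿cong x≈y)

  0≤x⇒∣x∣≈x : ∀ {x} → 0# ≤ x → ∣ x ∣ ≈ x
  0≤x⇒∣x∣≈x {x} 0≤x = x≤y⇒y⊔x≈y (≤-by (0≤-+ 0≤x 0≤x)
    (solve 1 (λ x → x := :- x :+ (x :+ x)) refl x))

  ∣-x∣≈∣x∣ : ∀ x → ∣ - x ∣ ≈ ∣ x ∣
  ∣-x∣≈∣x∣ x = trans (⊔-cong refl (-‿involutive x)) (⊔-comm _ _)
    where
    open RingProperties ring using (-‿involutive)
    open Max totalOrder using (⊔-comm)

  0≤⊎0≤- : ∀ x → (0# ≤ x) ⊎ (0# ≤ - x)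
  0≤⊎0≤- x with total 0# x
  ... | inj₁ 0≤x = inj₁ 0≤x
  ... | inj₂ x≤0 = inj₂ (≤-respʳ-≈ (+-identityˡ _) (≤⇒0≤ x≤0))

  0≤∣x∣ : ∀ x → 0# ≤ ∣ x ∣
  0≤∣x∣ x with 0≤⊎0≤- x
  ... | inj₁ 0≤x  = ≤-respʳ-≈ (sym (0≤x⇒∣x∣≈x 0≤x)) 0≤x
  ... | inj₂ 0≤-x = ≤-respʳ-≈ (trans (sym (0≤x⇒∣x∣≈x 0≤-x)) (∣-x∣≈∣x∣ x)) 0≤-x

  ∣x∣≈0⇒x≈0 : ∀ {x} → ∣ x ∣ ≈ 0# → x ≈ 0#
  ∣x∣≈0⇒x≈0 {x} ∣x∣≈0 with 0≤⊎0≤- x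
  ... | inj₁ 0≤x  = trans (sym (0≤x⇒∣x∣≈x 0≤x)) ∣x∣≈0
  ... | inj₂ 0≤-x = trans (solve 1 (λ x → x := 𝟘 :- (:- x)) refl x)
    (trans (+-congˡ (-‿cong (trans (sym (0≤x⇒∣x∣≈x 0≤-x)) (trans (∣-x∣≈∣x∣ x) ∣x∣≈0))))
      (-‿inverseʳ 0#))

  -- Growth of powers, and limits of eventually constant sequences.

  1≤-^ : ∀ {a} → 1# ≤ a → ∀ n → 1# ≤ a ^ n
  1≤-^ 1≤a zero = ≤-refl
  1≤-^ {a} 1≤a (suc n) = ≤-by
    (0≤-+ (≤⇒0≤ 1≤a) (*-nonNegative (≤-trans 0≤1 1≤a) (≤⇒0≤ (1≤-^ 1≤a n))))
    (solve 2 (λ a y → a :* y := 𝟙 :+ ((a :- 𝟙) :+ a :* (y :- 𝟙))) refl a (a ^ n))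

  -- The supremum of the powers of a below x is exceeded, after one more
  -- multiplication by a, by some power.
  powers-unbounded : ∀ {a} → 1# < a → ∀ x → ∃[ n ] x < a ^ n
  powers-unbounded {a} 1<a x with x <? 1#
  ... | yes x<1 = 0 , x<1
  ... | no  x≮1 = exceeded (proj₁ sup) (proj₂ sup)
    where
    Power : Carrier → Set (c ⊔ℓ ℓ₁ ⊔ℓ ℓ₂)
    Power y = Lift c (∃[ n ] (y ≈ a ^ n × a ^ n ≤ x))

    0<a : 0# < a
    0<a = <-trans 0<1 1<a

    exceeded : ∀ s → IsSup Power s → ∃[ n ] x < a ^ n
    exceeded s (bound , least) = beyond (least (s / a) s/a<s)
      where
      0<s : 0# < s
      0<s = <-≤-trans 0<1 (bound 1# (lift (0 , refl , ≮⇒≥ x≮1)))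

      s/a<s : s / a < s
      s/a<s = <-by (0<-* (0<-* 0<s (0<-⁻¹ 0<a)) (<⇒0< 1<a)) (begin
        s                                ≈⟨ +-vanish s (*-inverse 0<a) ⟨
        s + s * (a * a ⁻¹ - 1#)          ≈⟨ solve 3 (λ s a u → s :+ s :* (a :* u :- 𝟙) := s :* u :+ s :* u :* (a :- 𝟙)) refl s a (a ⁻¹) ⟩
        s * a ⁻¹ + s * a ⁻¹ * (a - 1#)   ∎)
        where open SetoidReasoning setoid

      beyond : ∃[ y ] (Power y × s / a < y) → ∃[ n ] x < a ^ n
      beyond (y , lift (n , y≈aⁿ , aⁿ≤x) , s/a<y) =
        suc n , ≰⇒> λ aⁿ⁺¹≤x → <⇒≱ s/a<y (≤-/ 0<a (≤-respˡ-≈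
          (trans (*-comm a (a ^ n)) (*-congʳ (sym y≈aⁿ)))
          (bound (a ^ suc n) (lift (suc n , refl , aⁿ⁺¹≤x)))))

    sup : ∃ (IsSup Power)
    sup = complete Power (1# , lift (0 , refl , ≮⇒≥ x≮1))
            (x , λ { y (lift (n , y≈aⁿ , aⁿ≤x)) → ≤-respˡ-≈ (sym y≈aⁿ) aⁿ≤x })

  ⟶-eventually : ∀ {f l} N → (∀ n → N ℕ.≤ n → f n ≈ l) → f ⟶ l
  ⟶-eventually N f≈l ε 0<ε = N , λ n N≤n →
    <-respˡ-≈ (sym (∣x∣≈0 (trans (+-congʳ (f≈l n N≤n)) (-‿inverseʳ _)))) 0<ε
    where
    ∣x∣≈0 : ∀ {x} → x ≈ 0# → ∣ x ∣ ≈ 0#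
    ∣x∣≈0 x≈0 = trans (0≤x⇒∣x∣≈x (≤-reflexive (sym x≈0))) x≈0

  -- If `∣ l - l′ ∣` were positive, it could be taken as ε: a late term of the sequence equals `l`,
  -- yet is closer to `l′` than `l` is.
  ⟶-eventually-unique : ∀ {f l l′} N → (∀ n → N ℕ.≤ n → f n ≈ l) → f ⟶ l′ → l ≈ l′
  ⟶-eventually-unique {f} {l} {l′} N f≈l f⟶l′ with ∣ l - l′ ∣ ≤? 0#
  ... | yes ∣l-l′∣≤0 = begin
    l                ≈⟨ solve 2 (λ x y → x := y :+ (x :- y)) refl l l′ ⟩
    l′ + (l - l′)    ≈⟨ +-congˡ (∣x∣≈0⇒x≈0 (antisym ∣l-l′∣≤0 (0≤∣x∣ _))) ⟩
    l′ + 0#          ≈⟨ +-identityʳ l′ ⟩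
    l′               ∎
    where open SetoidReasoning setoid
  ... | no ∣l-l′∣≰0 = let M , close = f⟶l′ ∣ l - l′ ∣ (≰⇒> ∣l-l′∣≰0) in
    ⊥-elim (<-irrefl (∣-∣-cong (+-congʳ (f≈l (N ℕ.⊔ M) (ℕ.m≤m⊔n N M))))
      (close (N ℕ.⊔ M) (ℕ.m≤n⊔m N M)))

-- Constants of the strategy and compact forms of the two ratios.

module Ratios {c ℓ₁ ℓ₂} (ℝ : RealNumbers c ℓ₁ ℓ₂) (p v a b : RealNumbers.Carrier ℝ)
  (0<p : RealNumbers._<_ ℝ (RealNumbers.0# ℝ) p) (p<1 : RealNumbers._<_ ℝ p (RealNumbers.1# ℝ))
  (0<v : RealNumbers._<_ ℝ (RealNumbers.0# ℝ) v) (v<1 : RealNumbers._<_ ℝ v (RealNumbers.1# ℝ))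
  (1<a : RealNumbers._<_ ℝ (RealNumbers.1# ℝ) a)
  (0≤b : RealNumbers._≤_ ℝ (RealNumbers.0# ℝ) b) (b≤1 : RealNumbers._≤_ ℝ b (RealNumbers.1# ℝ))
  where

  open RealProperties ℝ public
  open Search ℝ p v public
  open SetoidReasoning setoid

  -- Round i begins at time c₀ (a^i - 1) and scouts as far as w a^i.  Its slow leg
  -- passes distance z at time K r a^i + V z - c₀ and ends at time M a^i - c₀.
  -- A target at distance d, scouted on both ways in round j and found in round
  -- j + 2, has expected time L a^j + Q d - c₀.
  V g r w W K M c₀ q L Q ρ₁ ρ₂ : Carrier
  V  = v ⁻¹
  g  = (a - 1#) ⁻¹
  r  = (a ^ 2) ⁻¹
  w  = (a ^ 2 - 1#) * b + 1#
  W  = w ⁻¹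
  K  = 2# * a ^ 2 * w * g + a * (V - 1#)
  M  = K * r + V
  c₀ = (K + (V - 1#)) * r
  q  = 2# * p - p ^ 2
  L  = q * (M - 1#) + 2# * w * (p * (1# - p)) + (1# - p) ^ 2 * K
  Q  = p ^ 2 + (1# - p) ^ 2 * V
  ρ₁ = CR₁ a b
  ρ₂ = CR₂ a b

  0<a : 0# < a
  0<a = <-trans 0<1 1<a

  0<a² : 0# < a ^ 2
  0<a² = 0<-* 0<a (0<-* 0<a 0<1)

  0≤a²-1 : 0# ≤ a ^ 2 - 1#
  0≤a²-1 = ≤⇒0≤ (1≤-^ (<⇒≤ 1<a) 2)

  1≤w : 1# ≤ w
  1≤w = ≤-by (*-nonNegative 0≤a²-1 0≤b) (+-comm _ _)

  0<w : 0# < w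
  0<w = <-≤-trans 0<1 1≤w

  w≤a² : w ≤ a ^ 2
  w≤a² = ≤-by (*-nonNegative 0≤a²-1 (≤⇒0≤ b≤1))
    (solve 2 (λ A b → A := ((A :- 𝟙) :* b :+ 𝟙) :+ (A :- 𝟙) :* (𝟙 :- b)) refl (a ^ 2) b)

  vV≈1 : v * V ≈ 1#
  vV≈1 = *-inverse 0<v

  [a-1]g≈1 : (a - 1#) * g ≈ 1#
  [a-1]g≈1 = *-inverse (<⇒0< 1<a)

  a²r≈1 : a ^ 2 * r ≈ 1#
  a²r≈1 = *-inverse 0<a²

  wW≈1 : w * W ≈ 1#
  wW≈1 = *-inverse 0<w

  0≤V : 0# ≤ V
  0≤V = <⇒≤ (0<-⁻¹ 0<v)

  0≤g : 0# ≤ g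
  0≤g = <⇒≤ (0<-⁻¹ (<⇒0< 1<a))

  0<r : 0# < r
  0<r = 0<-⁻¹ 0<a²

  0≤r : 0# ≤ r
  0≤r = <⇒≤ 0<r

  0≤W : 0# ≤ W
  0≤W = <⇒≤ (0<-⁻¹ 0<w)

  0≤1-p : 0# ≤ 1# - p
  0≤1-p = <⇒≤ (<⇒0< p<1)

  0≤[1-p]² : 0# ≤ (1# - p) ^ 2
  0≤[1-p]² = *-nonNegative 0≤1-p (*-nonNegative 0≤1-p 0≤1)

  0≤q : 0# ≤ q
  0≤q = ≤-respʳ-≈ (solve 1 (λ p → p :* (𝟙 :+ (𝟙 :- p)) := 𝟚 :* p :- p :^ 2) refl p)
    (*-nonNegative (<⇒≤ 0<p) (0≤-+ 0≤1 0≤1-p))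

  0≤p[1-p] : 0# ≤ p * (1# - p)
  0≤p[1-p] = *-nonNegative (<⇒≤ 0<p) 0≤1-p

  0≤V-1 : 0# ≤ V - 1#
  0≤V-1 = ≤-respʳ-≈ (begin
    (1# - v) * V                        ≈⟨ solve 2 (λ v V → (𝟙 :- v) :* V := (V :- 𝟙) :+ (:- 𝟙) :* (v :* V :- 𝟙)) refl v V ⟩
    (V - 1#) + (- 1#) * (v * V - 1#)    ≈⟨ +-vanish _ vV≈1 ⟩
    V - 1#                              ∎)
    (*-nonNegative (≤⇒0≤ (<⇒≤ v<1)) 0≤V)

  0≤1-r : 0# ≤ 1# - r
  0≤1-r = ≤-respʳ-≈ (begin
    (a ^ 2 - 1#) * r                    ≈⟨ solve 2 (λ A r → (A :- 𝟙) :* r := (𝟙 :- r) :+ 𝟙 :* (A :* r :- 𝟙)) refl (a ^ 2) r ⟩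
    (1# - r) + 1# * (a ^ 2 * r - 1#)    ≈⟨ +-vanish _ a²r≈1 ⟩
    1# - r                              ∎)
    (*-nonNegative 0≤a²-1 0≤r)

  0≤K : 0# ≤ K
  0≤K = 0≤-+ (*-nonNegative (*-nonNegative (0≤-2* (<⇒≤ 0<a²)) (<⇒≤ 0<w)) 0≤g)
             (*-nonNegative (<⇒≤ 0<a) 0≤V-1)

  0≤c₀ : 0# ≤ c₀
  0≤c₀ = *-nonNegative (0≤-+ 0≤K 0≤V-1) 0≤r

  0≤M-1 : 0# ≤ M - 1#
  0≤M-1 = ≤-respʳ-≈ (sym (+-assoc _ _ _)) (0≤-+ (*-nonNegative 0≤K 0≤r) 0≤V-1)

  0≤L : 0# ≤ L
  0≤L = 0≤-+ (0≤-+ (*-nonNegative 0≤q 0≤M-1)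
                   (*-nonNegative (0≤-2* (<⇒≤ 0<w)) 0≤p[1-p]))
             (*-nonNegative 0≤[1-p]² 0≤K)

  -- Both sides are the length of round i divided by a ^ i.
  round-length : M + (w - 1#) + w ≈ c₀ * a
  round-length = sym (begin
    c₀ * a
      ≈⟨ solve 5 (λ a V g r w → let K = 𝟚 :* a :^ 2 :* w :* g :+ a :* (V :- 𝟙) in
           (K :+ (V :- 𝟙)) :* r :* a
           := ((K :* r :+ V) :+ (w :- 𝟙) :+ w) :+ (𝟚 :* w :+ V :- 𝟙) :* (a :^ 2 :* r :- 𝟙)
              :+ 𝟚 :* w :* a :^ 2 :* r :* ((a :- 𝟙) :* g :- 𝟙)) refl a V g r w ⟩
    (M + (w - 1#) + w) + (2# * w + V - 1#) * (a ^ 2 * r - 1#)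
      + 2# * w * a ^ 2 * r * ((a - 1#) * g - 1#)
      ≈⟨ +-vanish _ [a-1]g≈1 ⟩
    (M + (w - 1#) + w) + (2# * w + V - 1#) * (a ^ 2 * r - 1#)
      ≈⟨ +-vanish _ a²r≈1 ⟩
    M + (w - 1#) + w ∎)

  -- The right side is `(K * α + V * d) / d` at `d = w * α`, the cost per unit distance at the inner
  -- end of the unscouted range, with `c₀` left out. The correction terms in the solver call are
  -- multiples of the four inverse relations.
  ρ₁≈ : ρ₁ ≈ K * W + V
  ρ₁≈ = begin
    ρ₁
      ≈⟨ *-congˡ (+-congʳ (+-congˡ (*-congˡ inverse))) ⟩
    (1# * W) * (((a ^ 2 - 1#) * b) * V + N * (g * r * V) + 1#)
      ≈⟨ solve 7 (λ a b v V g r W →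
           let w = (a :^ 2 :- 𝟙) :* b :+ 𝟙
               K = 𝟚 :* a :^ 2 :* w :* g :+ a :* (V :- 𝟙)
               N = a :^ 2 :* (a :^ 2 :* (𝟚 :* (a :^ 2 :- 𝟙) :* b :* v :+ v :+ 𝟙) :+ v :- 𝟙)
               Y = g :* (𝟚 :* a :^ 2 :* (w :- 𝟙) :+ a :^ 2 :+ 𝟙)
               Z = g :* (a :^ 2 :- 𝟙) :* V
           in (𝟙 :* W) :* (((a :^ 2 :- 𝟙) :* b) :* V :+ N :* (g :* r :* V) :+ 𝟙)
              := K :* W :+ V
                 :+ W :* (v :* V :* Y :+ Z) :* (a :^ 2 :* r :- 𝟙)
                 :+ W :* Y :* (v :* V :- 𝟙)
                 :+ W :* (a :+ 𝟙) :* (V :- 𝟙) :* ((a :- 𝟙) :* g :- 𝟙)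
                 :+ V :* (w :* W :- 𝟙)) refl a b v V g r W ⟩
    _ ≈⟨ +-vanish _ wW≈1 ⟩
    _ ≈⟨ +-vanish _ [a-1]g≈1 ⟩
    _ ≈⟨ +-vanish _ vV≈1 ⟩
    _ ≈⟨ +-vanish _ a²r≈1 ⟩
    K * W + V ∎
    where
    N = a ^ 2 * (a ^ 2 * (2# * (a ^ 2 - 1#) * b * v + v + 1#) + v - 1#)

    inverse : ((a - 1#) * a ^ 2 * v) ⁻¹ ≈ g * r * V
    inverse = ⁻¹-unique (0<-* (0<-* (<⇒0< 1<a) 0<a²) 0<v) (begin
      (a - 1#) * a ^ 2 * v * (g * r * V)
        ≈⟨ solve 6 (λ x y z x′ y′ z′ → x :* y :* z :* (x′ :* y′ :* z′) := (x :* x′) :* (y :* y′) :* (z :* z′))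
             refl (a - 1#) (a ^ 2) v g r V ⟩
      ((a - 1#) * g) * (a ^ 2 * r) * (v * V)
        ≈⟨ *-cong (*-cong [a-1]g≈1 a²r≈1) vV≈1 ⟩
      1# * 1# * 1#
        ≈⟨ trans (*-identityʳ _) (*-identityʳ _) ⟩
      1# ∎)

  -- This is the mean time for `d = α = 1`, with `c₀` left out. The scouting passes come at `M` and
  -- `M + 2 (w - 1)` and are the first detection with probabilities `p` and `p (1 - p)`, whose sum
  -- is `q`; the slow pass comes at `K + V`, with the remaining probability `(1 - p) ^ 2`.
  ρ₂≈ : ρ₂ ≈ q * M + (1# - p) ^ 2 * (K + V) + 2# * (w - 1#) * (p * (1# - p))
  ρ₂≈ = sym (begin
    q * M + (1# - p) ^ 2 * (K + V) + 2# * (w - 1#) * (p * (1# - p))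
      ≈⟨ solve 7 (λ a b p v V g r →
           let w = (a :^ 2 :- 𝟙) :* b :+ 𝟙
               K = 𝟚 :* a :^ 2 :* w :* g :+ a :* (V :- 𝟙)
               q = 𝟚 :* p :- p :^ 2
           in q :* (K :* r :+ V) :+ (𝟙 :- p) :^ 2 :* (K :+ V) :+ 𝟚 :* (w :- 𝟙) :* (p :* (𝟙 :- p))
              := (a :+ 𝟙) :*
                 ( 𝟚 :* a :^ 2 :* b :* (p :- 𝟙) :^ 2
                 :+ a :* (𝟙 :* g :- 𝟚 :* b :* (p :- 𝟙) :* p)
                 :+ ((p :- 𝟚) :* p :* (v :- 𝟙)) :* (a :* r :* V)
                 :+ p :* (𝟚 :* b :+ p :- 𝟚)
                 :+ (p :- 𝟙) :^ 2 :* V )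
                 :+ (𝟚 :* w :* g :* q :- q :* (V :- 𝟙)) :* (a :^ 2 :* r :- 𝟙)
                 :+ (a :+ 𝟙) :* a :* r :* q :* (v :* V :- 𝟙)
                 :+ (b :* (a :+ 𝟙) :* (𝟚 :* q :+ 𝟚 :* a :^ 2 :* (𝟙 :- q)) :+ a :- 𝟚 :* q :* (a :+ 𝟙))
                    :* ((a :- 𝟙) :* g :- 𝟙)) refl a b p v V g r ⟩
    _ ≈⟨ +-vanish _ [a-1]g≈1 ⟩
    _ ≈⟨ +-vanish _ vV≈1 ⟩
    _ ≈⟨ +-vanish _ a²r≈1 ⟩
    _ ≈⟨ *-congˡ (+-congʳ (+-congʳ (+-congˡ (*-congˡ inverse)))) ⟨
    ρ₂ ∎)
    where
    inverse : (a * v) ⁻¹ ≈ a * r * V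
    inverse = ⁻¹-unique (0<-* 0<a 0<v) (begin
      a * v * (a * r * V)         ≈⟨ solve 4 (λ a v r V → a :* v :* (a :* r :* V) := (a :^ 2 :* r) :* (v :* V)) refl a v r V ⟩
      (a ^ 2 * r) * (v * V)       ≈⟨ *-cong a²r≈1 vV≈1 ⟩
      1# * 1#                     ≈⟨ *-identityʳ _ ⟩
      1#                          ∎)

  -- In `ρ₂≈`, the number `ρ₂` is a weighted mean of `M`, `M + 2 (w - 1)` and `K + V`, none of which
  -- is below `M = K r + V`, because `r ≤ 1`.
  M≤ρ₂ : M ≤ ρ₂
  M≤ρ₂ = ≤-by (0≤-+ (*-nonNegative 0≤[1-p]² (*-nonNegative 0≤K 0≤1-r))
                    (*-nonNegative (0≤-2* (≤⇒0≤ 1≤w)) 0≤p[1-p]))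
    (trans ρ₂≈ (solve 5 (λ p w K r V →
      (𝟚 :* p :- p :^ 2) :* (K :* r :+ V) :+ (𝟙 :- p) :^ 2 :* (K :+ V) :+ 𝟚 :* (w :- 𝟙) :* (p :* (𝟙 :- p))
      := (K :* r :+ V) :+ ((𝟙 :- p) :^ 2 :* (K :* (𝟙 :- r)) :+ 𝟚 :* (w :- 𝟙) :* (p :* (𝟙 :- p))))
      refl p w K r V))

  ρ₂≈L+Q : ρ₂ ≈ L + Q
  ρ₂≈L+Q = trans ρ₂≈ (solve 5 (λ p w K M V →
    let q = 𝟚 :* p :- p :^ 2 in
    q :* M :+ (𝟙 :- p) :^ 2 :* (K :+ V) :+ 𝟚 :* (w :- 𝟙) :* (p :* (𝟙 :- p))
    := (q :* (M :- 𝟙) :+ 𝟚 :* w :* (p :* (𝟙 :- p)) :+ (𝟙 :- p) :^ 2 :* K) :+ (p :^ 2 :+ (𝟙 :- p) :^ 2 :* V))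
    refl p w K M V)

  -- Bounds for the expected times.

  unscouted-bound : ∀ {α d} → w * α ≤ d → K * α + V * d - c₀ ≤ ρ₁ * d
  unscouted-bound {α} {d} wα≤d = ≤-by
    (0≤-+ (*-nonNegative (*-nonNegative 0≤K 0≤W) (≤⇒0≤ wα≤d)) 0≤c₀) (begin
    ρ₁ * d
      ≈⟨ *-congʳ ρ₁≈ ⟩
    (K * W + V) * d
      ≈⟨ solve 7 (λ α d w K W V c → (K :* W :+ V) :* d
           := (K :* α :+ V :* d :- c) :+ (K :* W :* (d :- w :* α) :+ c) :+ K :* α :* (w :* W :- 𝟙))
           refl α d w K W V c₀ ⟩
    (K * α + V * d - c₀) + (K * W * (d - w * α) + c₀) + K * α * (w * W - 1#)
      ≈⟨ +-vanish _ wW≈1 ⟩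
    (K * α + V * d - c₀) + (K * W * (d - w * α) + c₀) ∎)

  scouted-bound : ∀ {α d} → α ≤ d → L * α + Q * d - c₀ ≤ ρ₂ * d
  scouted-bound {α} {d} α≤d = ≤-by (0≤-+ (*-nonNegative 0≤L (≤⇒0≤ α≤d)) 0≤c₀)
    (trans (*-congʳ ρ₂≈L+Q) (solve 5 (λ α d L Q c →
      (L :+ Q) :* d := (L :* α :+ Q :* d :- c) :+ (L :* (d :- α) :+ c)) refl α d L Q c₀))

  -- Meant for a target at the far end of the first slow leg on its side, which is reached at time
  -- `M * d - c₀`.
  first-visit-bound : ∀ {d} → 0# ≤ d → M * d - c₀ ≤ ρ₂ * d
  first-visit-bound {d} 0≤d = ≤-by (0≤-+ (*-nonNegative (≤⇒0≤ M≤ρ₂) 0≤d) 0≤c₀)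
    (solve 4 (λ d M ρ c → ρ :* d := (M :* d :- c) :+ ((ρ :- M) :* d :+ c)) refl d M ρ₂ c₀)

  -- The outward scouting pass of a round precedes the slow pass two rounds later, so a detection
  -- while scouting can only lower the mean.
  scout-before-slow : ∀ {α d} → 0# ≤ α → α ≤ d → M * α + (d - α) - c₀ ≤ K * α + V * d - c₀
  scout-before-slow {α} {d} 0≤α α≤d = ≤-by
    (0≤-+ (*-nonNegative (*-nonNegative 0≤K 0≤1-r) 0≤α) (*-nonNegative 0≤V-1 (≤⇒0≤ α≤d)))
    (solve 6 (λ α d K r V c → K :* α :+ V :* d :- c
      := ((K :* r :+ V) :* α :+ (d :- α) :- c) :+ (K :* (𝟙 :- r) :* α :+ (V :- 𝟙) :* (d :- α)))
      refl α d K r V c₀)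

  -- Here `w` is one, so `ρ₁` is `K + V`, while `ρ₂` is the mean of `M` and `K + V` with weights `q`
  -- and `(1 - p) ^ 2`.
  b≈0⇒ρ₂≤ρ₁ : b ≈ 0# → ρ₂ ≤ ρ₁
  b≈0⇒ρ₂≤ρ₁ b≈0 = ≤-by (*-nonNegative 0≤q (*-nonNegative 0≤K 0≤1-r)) (begin
    ρ₁
      ≈⟨ ρ₁≈ ⟩
    K * W + V
      ≈⟨ +-congʳ (*-congˡ (⁻¹-unique 0<w (trans (*-identityʳ w) w≈1))) ⟩
    K * 1# + V
      ≈⟨ solve 5 (λ p w K r V → let q = 𝟚 :* p :- p :^ 2 in K :* 𝟙 :+ V
           := q :* (K :* r :+ V) :+ (𝟙 :- p) :^ 2 :* (K :+ V) :+ 𝟚 :* (w :- 𝟙) :* (p :* (𝟙 :- p))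
              :+ q :* (K :* (𝟙 :- r)) :+ (:- 𝟚 :* p :* (𝟙 :- p)) :* (w :- 𝟙)) refl p w K r V ⟩
    _ ≈⟨ +-vanish _ w≈1 ⟩
    _ ≈⟨ +-congʳ ρ₂≈ ⟨
    ρ₂ + q * (K * (1# - r)) ∎)
    where
    w≈1 : w ≈ 1#
    w≈1 = trans (+-congʳ (trans (*-congˡ b≈0) (zeroʳ _))) (+-identityˡ 1#)

  -- Here `w` is `a ^ 2`, so `W` is `r` and `ρ₁` is `M`.
  b≈1⇒ρ₁≤ρ₂ : b ≈ 1# → ρ₁ ≤ ρ₂
  b≈1⇒ρ₁≤ρ₂ b≈1 = ≤-respˡ-≈ (sym (trans ρ₁≈ (+-congʳ (*-congˡ W≈r)))) M≤ρ₂
    where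
    W≈r : W ≈ r
    W≈r = ⁻¹-cong (trans (+-congʳ (trans (*-congˡ b≈1) (*-identityʳ _)))
      (solve 1 (λ A → (A :- 𝟙) :+ 𝟙 := A) refl (a ^ 2)))

  -- For the targets ω a^j + δ with ω and δ fixed, the bounded terms of the
  -- expected time become negligible as j grows.
  asymptotically-exceeded : ∀ {F G ω δ y} → 0# < F + (G - y) * ω →
    ∃[ j ] (1# < a ^ j × y * (ω * a ^ j + δ) < F * a ^ j + G * (ω * a ^ j + δ) - c₀)
  asymptotically-exceeded {F} {G} {ω} {δ} {y} 0<θ = found (powers-unbounded 1<a (B ⊔ 1#))
    where
    θ s B : Carrier
    θ = F + (G - y) * ω
    s = c₀ + (y - G) * δ
    B = s / θ
    found : ∃[ j ] B ⊔ 1# < a ^ j →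
      ∃[ j ] (1# < a ^ j × y * (ω * a ^ j + δ) < F * a ^ j + G * (ω * a ^ j + δ) - c₀)
    found (j , <aʲ) = j , ≤-<-trans (x≤y⊔x B 1#) <aʲ ,
      <-by (<⇒0< (/-<⁻ 0<θ (≤-<-trans (x≤x⊔y B 1#) <aʲ)))
        (solve 7 (λ F G ω δ y α c →
          F :* α :+ G :* (ω :* α :+ δ) :- c
          := y :* (ω :* α :+ δ) :+ (α :* (F :+ (G :- y) :* ω) :- (c :+ (y :- G) :* δ)))
          refl F G ω δ y (a ^ j) c₀)

  -- Reflection in the origin, and the effect of a single leg.

  Sign : Carrier → Set ℓ₁
  Sign s = (s ≈ 1#) ⊎ (s ≈ - 1#)

  -- Reflection exchanges the two cases of `Passes` and respects the half-open ends. Thus every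
  -- round can be analysed as if it went in the positive direction.
  Passes-flip : ∀ {s F D X f d x} → Sign s → F ≈ s * f → D ≈ s * d → X ≈ s * x →
                Passes f d x → Passes F D X
  Passes-flip {s} (inj₁ s≈1) F≈ D≈ X≈ = λ
    { (inj₁ (f<x , x≤d)) → inj₁ (<-resp-≈₂ (same F≈) (same X≈) f<x , ≤-resp-≈ (same X≈) (same D≈) x≤d)
    ; (inj₂ (d≤x , x<f)) → inj₂ (≤-resp-≈ (same D≈) (same X≈) d≤x , <-resp-≈₂ (same X≈) (same F≈) x<f) }
    where
    same : ∀ {Y y} → Y ≈ s * y → y ≈ Y
    same Y≈ = sym (trans Y≈ (1*-≈ s≈1))
  Passes-flip {s} (inj₂ s≈-1) F≈ D≈ X≈ = λ
    { (inj₁ (f<x , x≤d)) → inj₂ (≤-resp-≈ (opposite D≈) (opposite X≈) (neg-mono-≤ x≤d) ,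
                                 <-resp-≈₂ (opposite X≈) (opposite F≈) (neg-mono-< f<x))
    ; (inj₂ (d≤x , x<f)) → inj₁ (<-resp-≈₂ (opposite F≈) (opposite X≈) (neg-mono-< x<f) ,
                                 ≤-resp-≈ (opposite X≈) (opposite D≈) (neg-mono-≤ d≤x)) }
    where
    opposite : ∀ {Y y} → Y ≈ s * y → - y ≈ Y
    opposite Y≈ = sym (trans Y≈ (-1*-≈ s≈-1))

  sign² : ∀ {s} → Sign s → s * s ≈ 1#
  sign² (inj₁ s≈1)  = trans (1*-≈ s≈1) s≈1
  sign² (inj₂ s≈-1) = trans (*-cong s≈-1 s≈-1) (solve 0 (:- 𝟙 :* :- 𝟙 := 𝟙) refl)

  sign-cancel : ∀ {s x y} → Sign s → x ≈ s * y → y ≈ s * x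
  sign-cancel {s} {x} {y} sgn x≈sy = sym (begin
    s * x         ≈⟨ *-congˡ x≈sy ⟩
    s * (s * y)   ≈⟨ *-assoc s s y ⟨
    s * s * y     ≈⟨ 1*-≈ (sign² sgn) ⟩
    y             ∎)

  ∣sign*-∣ : ∀ {s x} → Sign s → ∣ s * x ∣ ≈ ∣ x ∣
  ∣sign*-∣ (inj₁ s≈1)  = ∣-∣-cong (1*-≈ s≈1)
  ∣sign*-∣ (inj₂ s≈-1) = trans (∣-∣-cong (-1*-≈ s≈-1)) (∣-x∣≈∣x∣ _)

  outward-miss : ∀ {f d x} → f ≤ d → (x ≤ f) ⊎ (d < x) → ¬ Passes f d x
  outward-miss f≤d (inj₁ x≤f) (inj₁ (f<x , _))   = <⇒≱ f<x x≤f
  outward-miss f≤d (inj₂ d<x) (inj₁ (_ , x≤d))   = <⇒≱ d<x x≤d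
  outward-miss f≤d _          (inj₂ (d≤x , x<f)) = <⇒≱ x<f (≤-trans f≤d d≤x)

  inward-miss : ∀ {f d x} → d ≤ f → (x < d) ⊎ (f ≤ x) → ¬ Passes f d x
  inward-miss d≤f _          (inj₁ (f<x , x≤d)) = <⇒≱ f<x (≤-trans x≤d d≤f)
  inward-miss d≤f (inj₁ x<d) (inj₂ (d≤x , _))   = <⇒≱ x<d d≤x
  inward-miss d≤f (inj₂ f≤x) (inj₂ (_ , x<f))   = <⇒≱ x<f f≤x

  -- Real numbers form a setoid, so the state is described componentwise up to `≈`.
  record At (st : State) (P t u e : Carrier) : Set ℓ₁ where
    constructor known
    field
      position≈   : position st ≈ P
      time≈       : time st ≈ t
      undetected≈ : undetected st ≈ u
      partial≈    : partial st ≈ e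

  rate : Mode → Carrier
  rate fast = 1#
  rate slow = V

  speed⁻¹ : ∀ m → speed m ⁻¹ ≈ rate m
  speed⁻¹ fast = ⁻¹-unique 0<1 (*-identityʳ 1#)
  speed⁻¹ slow = refl

  module Legs {s x z} (sgn : Sign s) (x≈sz : x ≈ s * z) where

    distance : ∀ {X F y f} → X ≈ s * y → F ≈ s * f → ∣ X - F ∣ ≈ ∣ y - f ∣
    distance {X} {F} {y} {f} X≈ F≈ = begin
      ∣ X - F ∣           ≈⟨ ∣-∣-cong (+-cong X≈ (-‿cong F≈)) ⟩
      ∣ s * y - s * f ∣   ≈⟨ ∣-∣-cong (solve 3 (λ s y f → s :* y :- s :* f := s :* (y :- f)) refl s y f) ⟩
      ∣ s * (y - f) ∣     ≈⟨ ∣sign*-∣ sgn ⟩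
      ∣ y - f ∣           ∎

    elapsed : ∀ {X F y f t t₀ t₁} m → X ≈ s * y → F ≈ s * f → t ≈ t₀ →
              t₀ + ∣ y - f ∣ * rate m ≈ t₁ → t + ∣ X - F ∣ / speed m ≈ t₁
    elapsed m X≈ F≈ t≈ ≈t₁ = trans (+-cong t≈ (*-cong (distance X≈ F≈) (speed⁻¹ m))) ≈t₁

    miss : ∀ {st f d t u e D t′} m → At st (s * f) t u e → D ≈ s * d → ¬ Passes f d z →
           t + ∣ d - f ∣ * rate m ≈ t′ → At (step x st (D at m)) (s * d) t′ u e
    miss {st} {D = D} m (known P≈ t≈ u≈ e≈) D≈ ¬pass ≈t′ with passes? (position st) D x
    -- Since `s * s ≈ 1#`, multiplying by `s` once more carries the pass back to the reflected
    -- coordinates.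
    ... | yes pass = ⊥-elim (¬pass (Passes-flip sgn (sign-cancel sgn P≈) (sign-cancel sgn D≈) (sign-cancel sgn x≈sz) pass))
    ... | no  _    = known D≈ (elapsed m D≈ P≈ t≈ ≈t′) u≈ e≈

    hit : ∀ {st f d t u e D t′ τ} m → At st (s * f) t u e → D ≈ s * d → Passes f d z →
          t + ∣ d - f ∣ * rate m ≈ t′ → t + ∣ z - f ∣ * rate m ≈ τ →
          At (step x st (D at m)) (s * d) t′ (u * (1# - detection m)) (e + u * detection m * τ)
    hit {st} {D = D} m (known P≈ t≈ u≈ e≈) D≈ pass ≈t′ ≈τ with passes? (position st) D x
    ... | yes _    = known D≈ (elapsed m D≈ P≈ t≈ ≈t′) (*-congʳ u≈)
                       (+-cong e≈ (*-cong (*-congʳ u≈) (elapsed m x≈sz P≈ t≈ ≈τ)))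
    ... | no ¬pass = ⊥-elim (¬pass (Passes-flip sgn P≈ D≈ x≈sz pass))

  side : ℕ → Carrier
  side i = (- 1#) ^ (i ℕ.+ 1)

  side-suc : ∀ i → side (suc i) ≈ - side i
  side-suc i = -1*-≈ refl

  side-2+ : ∀ i → side (2 ℕ.+ i) ≈ side i
  side-2+ i = solve 1 (λ s → :- 𝟙 :* (:- 𝟙 :* s) := s) refl (side i)

  side-sign : ∀ i → Sign (side i)
  side-sign zero    = inj₂ (*-identityʳ _)
  side-sign (suc i) with side-sign i
  ... | inj₁ s≈1  = inj₂ (trans (side-suc i) (-‿cong s≈1))
  ... | inj₂ s≈-1 = inj₁ (trans (side-suc i) (trans (-‿cong s≈-1) (solve 0 (:- (:- 𝟙) := 𝟙) refl)))

  ^-homo-2+ : ∀ i → a ^ (i ℕ.+ 2) ≈ a ^ 2 * a ^ i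
  ^-homo-2+ i = trans (Exp.^-homo-* semiring a i 2) (*-comm _ _)

  -- The course of a single round.

  startTime slowEnd scoutEnd : Carrier → Carrier
  startTime α = c₀ * (α - 1#)
  slowEnd   α = M * α - c₀
  scoutEnd  α = M * α + (w - 1#) * α - c₀

  slowPass outPass inPass : (α z : Carrier) → Carrier
  slowPass α z = K * (r * α) + V * z - c₀
  outPass  α z = M * α + (z - α) - c₀
  inPass   α z = scoutEnd α + (w * α - z)

  Settled : State → Carrier → Set ℓ₁
  Settled st E = undetected st ≈ 0# × partial st ≈ E

  -- Whatever a pass adds to `partial` carries the factor `undetected`, which is already zero.
  step-settled : ∀ {x st E} l → Settled st E → Settled (step x st l) E
  step-settled {x} {st} (D at m) (u≈0 , e≈E) with passes? (position st) D x
  ... | no  _ = u≈0 , e≈E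
  ... | yes _ = trans (*-congʳ u≈0) (zeroˡ _) ,
                trans (+-cong e≈E (trans (*-congʳ (trans (*-congʳ u≈0) (zeroˡ _))) (zeroˡ _)))
                      (+-identityʳ _)

  foldl-settled : ∀ {x st E} ls → Settled st E → Settled (foldl (step x) st ls) E
  foldl-settled []       settled = settled
  foldl-settled (l ∷ ls) settled = foldl-settled ls (step-settled l settled)

  -- Coordinates are multiplied by `side i`, so that the round goes in the positive direction. The
  -- target becomes `z`, which is negative if the target lies on the other side.
  module Round (i : ℕ) {x z} (x≈ : x ≈ side i * z) where

    open Legs (side-sign i) x≈

    α : Carrier
    α = a ^ i

    0≤α : 0# ≤ α
    0≤α = ≤-trans 0≤1 (1≤-^ (<⇒≤ 1<a) i)

    0≤rα : 0# ≤ r * α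
    0≤rα = *-nonNegative 0≤r 0≤α

    rα≤α : r * α ≤ α
    rα≤α = ≤-by (*-nonNegative 0≤1-r 0≤α) (solve 2 (λ r α → α := r :* α :+ (𝟙 :- r) :* α) refl r α)

    α≤wα : α ≤ w * α
    α≤wα = ≤-by (*-nonNegative (≤⇒0≤ 1≤w) 0≤α) (solve 2 (λ w α → w :* α := α :+ (w :- 𝟙) :* α) refl w α)

    0≤wα : 0# ≤ w * α
    0≤wα = ≤-trans 0≤α α≤wα

    out : ∀ {f d} → f ≤ d → ∣ d - f ∣ ≈ d - f
    out f≤d = 0≤x⇒∣x∣≈x (≤⇒0≤ f≤d)

    back : ∀ {f d} → d ≤ f → ∣ d - f ∣ ≈ f - d
    back {f} {d} d≤f = trans (sym (∣-x∣≈∣x∣ _))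
      (trans (∣-∣-cong (solve 2 (λ f d → :- (d :- f) := f :- d) refl f d)) (out d≤f))

    after : ∀ {t ℓ ℓ′ ρ t′} → ℓ ≈ ℓ′ → t + ℓ′ * ρ ≈ t′ → t + ℓ * ρ ≈ t′
    after ℓ≈ℓ′ = trans (+-congˡ (*-congʳ ℓ≈ℓ′))

    approach-time : startTime α + ∣ r * α - 0# ∣ * 1# ≈ startTime α + r * α
    approach-time = after (out 0≤rα)
      (solve 2 (λ t y → t :+ (y :- 𝟘) :* 𝟙 := t :+ y) refl _ (r * α))

    slow-pass-time : ∀ {y} → r * α ≤ y → startTime α + r * α + ∣ y - r * α ∣ * V ≈ slowPass α y
    slow-pass-time {y} rα≤y = after (out rα≤y)
      (solve 5 (λ K V r α y → let c = (K :+ (V :- 𝟙)) :* r in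
        c :* (α :- 𝟙) :+ r :* α :+ (y :- r :* α) :* V := K :* (r :* α) :+ V :* y :- c)
        refl K V r α y)

    slow-time : startTime α + r * α + ∣ α - r * α ∣ * V ≈ slowEnd α
    slow-time = trans (slow-pass-time rα≤α)
      (solve 5 (λ K V r α c → K :* (r :* α) :+ V :* α :- c := (K :* r :+ V) :* α :- c)
        refl K V r α c₀)

    out-pass-time : ∀ {y} → α ≤ y → slowEnd α + ∣ y - α ∣ * 1# ≈ outPass α y
    out-pass-time {y} α≤y = after (out α≤y)
      (solve 4 (λ M α y c → M :* α :- c :+ (y :- α) :* 𝟙 := M :* α :+ (y :- α) :- c) refl M α y c₀)

    scout-time : slowEnd α + ∣ w * α - α ∣ * 1# ≈ scoutEnd α
    scout-time = trans (out-pass-time α≤wα)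
      (solve 4 (λ M α w c → M :* α :+ (w :* α :- α) :- c := M :* α :+ (w :- 𝟙) :* α :- c) refl M α w c₀)

    in-pass-time : ∀ {y} → y ≤ w * α → scoutEnd α + ∣ y - w * α ∣ * 1# ≈ inPass α y
    in-pass-time {y} y≤wα = after (back y≤wα) (+-congˡ (*-identityʳ _))

    -- Apart from `- c₀`, the round ends at `(M + (w - 1#) + w) * α`. By `round-length` this is
    -- `c₀ * a * α`, which makes the start times of the rounds fit together.
    return-time : scoutEnd α + ∣ 0# - w * α ∣ * 1# ≈ startTime (a ^ suc i)
    return-time = trans (in-pass-time 0≤wα) (begin
      M * α + (w - 1#) * α - c₀ + (w * α - 0#)
        ≈⟨ solve 4 (λ M α w c → M :* α :+ (w :- 𝟙) :* α :- c :+ (w :* α :- 𝟘) := (M :+ (w :- 𝟙) :+ w) :* α :- c) refl M α w c₀ ⟩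
      (M + (w - 1#) + w) * α - c₀   ≈⟨ +-congʳ (*-congʳ round-length) ⟩
      c₀ * a * α - c₀               ≈⟨ solve 3 (λ c a α → c :* a :* α :- c := c :* (a :* α :- 𝟙)) refl c₀ a α ⟩
      c₀ * (a * α - 1#)             ∎)

    dest₁ : side i * (a ^ i / a ^ 2) ≈ side i * (r * α)
    dest₁ = *-congˡ (*-comm _ _)

    dest₃ : side i * (a ^ i + b * (a ^ (i ℕ.+ 2) - a ^ i)) ≈ side i * (w * α)
    dest₃ = *-congˡ (trans (+-congˡ (*-congˡ (+-congʳ (^-homo-2+ i))))
      (solve 3 (λ b A α → α :+ b :* (A :* α :- α) := ((A :- 𝟙) :* b :+ 𝟙) :* α) refl b (a ^ 2) α))

    dest₄ : 0# ≈ side i * 0#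
    dest₄ = sym (zeroʳ _)

    enter : ∀ {st t u e} → At st 0# t u e → At st (side i * 0#) t u e
    enter (known P≈ t≈ u≈ e≈) = known (trans P≈ dest₄) t≈ u≈ e≈

    leave : ∀ {st t u e} → At st (side i * 0#) t u e → At st 0# t u e
    leave (known P≈ t≈ u≈ e≈) = known (trans P≈ (sym dest₄)) t≈ u≈ e≈

    missed : ∀ {l st u e} → l ≡ algorithm a b i → At st 0# (startTime α) u e → (z < 0#) ⊎ (w * α < z) →
             At (foldl (step x) st l) 0# (startTime (a ^ suc i)) u e
    missed ≡.refl A (inj₁ z<0) = leave
      (miss fast (miss fast (miss slow (miss fast (enter A)
        dest₁ (outward-miss 0≤rα (inj₁ (<⇒≤ z<0))) approach-time)
        refl  (outward-miss rα≤α (inj₁ (≤-trans (<⇒≤ z<0) 0≤rα))) slow-time)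
        dest₃ (outward-miss α≤wα (inj₁ (≤-trans (<⇒≤ z<0) 0≤α))) scout-time)
        dest₄ (inward-miss 0≤wα (inj₁ z<0)) return-time)
    missed ≡.refl A (inj₂ wα<z) = leave
      (miss fast (miss fast (miss slow (miss fast (enter A)
        dest₁ (outward-miss 0≤rα (inj₂ (≤-<-trans rα≤α α<z))) approach-time)
        refl  (outward-miss rα≤α (inj₂ α<z)) slow-time)
        dest₃ (outward-miss α≤wα (inj₂ wα<z)) scout-time)
        dest₄ (inward-miss 0≤wα (inj₂ (<⇒≤ wα<z))) return-time)
      where
      α<z : α < z
      α<z = ≤-<-trans α≤wα wα<z

    scouted : ∀ {l st u e} → l ≡ algorithm a b i → At st 0# (startTime α) u e → α < z → z < w * α →
              At (foldl (step x) st l) 0# (startTime (a ^ suc i))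
                 (u * (1# - p) * (1# - p))
                 (e + u * p * outPass α z + u * (1# - p) * p * inPass α z)
    scouted ≡.refl A α<z z<wα = leave
      (hit fast (hit fast (miss slow (miss fast (enter A)
        dest₁ (outward-miss 0≤rα (inj₂ (≤-<-trans rα≤α α<z))) approach-time)
        refl  (outward-miss rα≤α (inj₂ α<z)) slow-time)
        dest₃ (inj₁ (α<z , <⇒≤ z<wα)) scout-time (out-pass-time (<⇒≤ α<z)))
        dest₄ (inj₂ (≤-trans 0≤α (<⇒≤ α<z) , z<wα)) return-time (in-pass-time (<⇒≤ z<wα)))

    -- The target is the turning point: the outward leg includes its destination, but the return leg
    -- excludes its starting point, so there is only one pass.
    scouted-once : ∀ {l st u e} → l ≡ algorithm a b i → At st 0# (startTime α) u e → α < z → z ≈ w * α →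
                   At (foldl (step x) st l) 0# (startTime (a ^ suc i))
                      (u * (1# - p)) (e + u * p * outPass α z)
    scouted-once ≡.refl A α<z z≈wα = leave
      (miss fast (hit fast (miss slow (miss fast (enter A)
        dest₁ (outward-miss 0≤rα (inj₂ (≤-<-trans rα≤α α<z))) approach-time)
        refl  (outward-miss rα≤α (inj₂ α<z)) slow-time)
        dest₃ (inj₁ (α<z , ≤-reflexive z≈wα)) scout-time (out-pass-time (<⇒≤ α<z)))
        dest₄ (inward-miss 0≤wα (inj₂ (≤-reflexive (sym z≈wα)))) return-time)

    found : ∀ {l st u e} → l ≡ algorithm a b i → At st 0# (startTime α) u e → r * α < z → z ≤ α →
            Settled (foldl (step x) st l) (e + u * slowPass α z)
    -- The slow leg leaves `undetected` at `u * (1# - 1#)`; the two outer steps are the scouting leg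
    -- and the return leg, which change nothing any more.
    found ≡.refl A rα<z z≤α = step-settled _ (step-settled _ (settle
      (hit slow (miss fast (enter A)
        dest₁ (outward-miss 0≤rα (inj₂ rα<z)) approach-time)
        refl  (inj₁ (rα<z , z≤α)) slow-time (slow-pass-time (<⇒≤ rα<z)))))
      where
      settle : ∀ {st P t u e τ} → At st P t (u * (1# - 1#)) (e + u * 1# * τ) → Settled st (e + u * τ)
      settle {u = u} {e} {τ} (known _ _ u≈ e≈) =
        trans u≈ (solve 1 (λ u → u :* (𝟙 :- 𝟙) := 𝟘) refl u) ,
        trans e≈ (+-congˡ (*-congʳ (*-identityʳ u)))

  -- Comparison of different rounds.

  same-or-opposite : ∀ {s t} → Sign s → Sign t → (s ≈ t) ⊎ (s ≈ - t)
  same-or-opposite (inj₁ s≈1)  (inj₁ t≈1)  = inj₁ (trans s≈1 (sym t≈1))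
  same-or-opposite (inj₁ s≈1)  (inj₂ t≈-1) =
    inj₂ (trans s≈1 (sym (trans (-‿cong t≈-1) (solve 0 (:- (:- 𝟙) := 𝟙) refl))))
  same-or-opposite (inj₂ s≈-1) (inj₁ t≈1)  = inj₂ (trans s≈-1 (-‿cong (sym t≈1)))
  same-or-opposite (inj₂ s≈-1) (inj₂ t≈-1) = inj₁ (trans s≈-1 (sym t≈-1))

  ^-monoʳ-≤ : ∀ {i j} → i ℕ.≤ j → a ^ i ≤ a ^ j
  ^-monoʳ-≤ {j = j} ℕ.z≤n = 1≤-^ (<⇒≤ 1<a) j
  ^-monoʳ-≤ (ℕ.s≤s {i} {j} i≤j) = ≤-by (*-nonNegative (<⇒≤ 0<a) (≤⇒0≤ (^-monoʳ-≤ i≤j)))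
    (solve 3 (λ a x y → a :* y := a :* x :+ a :* (y :- x)) refl a (a ^ i) (a ^ j))

  0<-^ : ∀ i → 0# < a ^ i
  0<-^ i = <-≤-trans 0<1 (1≤-^ (<⇒≤ 1<a) i)

  ra²α≈α : ∀ j → r * a ^ (2 ℕ.+ j) ≈ a ^ j
  ra²α≈α j = begin
    r * (a * (a * a ^ j))   ≈⟨ solve 3 (λ a r α → r :* (a :* (a :* α)) := (a :^ 2 :* r) :* α) refl a r (a ^ j) ⟩
    (a ^ 2 * r) * a ^ j     ≈⟨ 1*-≈ a²r≈1 ⟩
    a ^ j                   ∎

  rα<α : ∀ j → r * a ^ j < a ^ j
  rα<α j = <-by (0<-* (0<-* 0<r 0<a²-1) (0<-^ j)) (begin
    a ^ j
      ≈⟨ 1*-≈ a²r≈1 ⟨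
    (a ^ 2 * r) * a ^ j
      ≈⟨ solve 3 (λ A r α → (A :* r) :* α := r :* α :+ r :* (A :- 𝟙) :* α) refl (a ^ 2) r (a ^ j) ⟩
    r * a ^ j + r * (a ^ 2 - 1#) * a ^ j ∎)
    where
    0<a²-1 : 0# < a ^ 2 - 1#
    0<a²-1 = <-respʳ-≈ (solve 1 (λ a → (a :- 𝟙) :* (𝟙 :+ a) := a :^ 2 :- 𝟙) refl a)
      (0<-* (<⇒0< 1<a) (0<-+ 0<1 (<⇒≤ 0<a)))

  -- The scouting of a round never goes beyond the slow leg of the next round on the same side. This
  -- is where `b ≤ 1#` enters, through `w≤a²`.
  wα≤a²α : ∀ i → w * a ^ i ≤ a ^ (2 ℕ.+ i)
  wα≤a²α i = ≤-by (*-nonNegative (≤⇒0≤ w≤a²) (<⇒≤ (0<-^ i)))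
    (solve 3 (λ a w α → a :* (a :* α) := w :* α :+ (a :^ 2 :- w) :* α) refl a w (a ^ i))

  slowPass-2+ : ∀ j {d} → slowPass (a ^ (2 ℕ.+ j)) d ≈ K * a ^ j + V * d - c₀
  slowPass-2+ j = +-congʳ (+-congʳ (*-congˡ (ra²α≈α j)))

  -- The strategy is a variable so that states are compared without unfolding
  -- the legs of a round.
  module Play (σ : Strategy) (σ≡ : ∀ i → σ i ≡ algorithm a b i) where

    Missed : Carrier → ℕ → Set _
    Missed x i = ∃[ z ] (x ≈ side i * z × ((z < 0#) ⊎ (w * a ^ i < z)))

    all-missed : ∀ {x} n → (∀ i → i ℕ.< n → Missed x i) →
                 At (afterRounds σ x n) 0# (startTime (a ^ n)) 1# 0#
    all-missed zero    _      = known refl (sym (trans (*-congˡ (-‿inverseʳ 1#)) (zeroʳ c₀))) refl refl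
    all-missed (suc n) missed = let z , x≈ , where? = missed n ℕ.≤-refl in
      Round.missed n x≈ (σ≡ n) (all-missed n λ i i<n → missed i (ℕ.m≤n⇒m≤1+n i<n)) where?

    -- Uniqueness is included because the upper bound has to deal with an arbitrary expected time of
    -- the target.
    Expects : Carrier → Carrier → Set _
    Expects x E = HasExpectedTime σ x E × (∀ E′ → HasExpectedTime σ x E′ → E ≈ E′)

    -- From round `k` on, both sequences are constant, so the limits are attained after finitely
    -- many rounds.
    found⇒expects : ∀ {x d u e E} k → x ≈ side k * d → r * a ^ k < d → d ≤ a ^ k →
      At (afterRounds σ x k) 0# (startTime (a ^ k)) u e → e + u * slowPass (a ^ k) d ≈ E →
      Expects x E
    found⇒expects {x} {d} {u} {e} {E} k x≈ rα<d d≤α A ≈E =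
      (⟶-eventually (suc k) (λ n k<n → proj₁ (settled k<n)) , ⟶-eventually (suc k) partial≈E) ,
      λ E′ (_ , partial⟶E′) → ⟶-eventually-unique (suc k) partial≈E partial⟶E′
      where
      -- The order `≤′` grows at its upper end, just as `afterRounds` appends rounds.
      settled′ : ∀ {n} → suc k ℕ.≤′ n → Settled (afterRounds σ x n) (e + u * slowPass (a ^ k) d)
      settled′ ℕ.≤′-refl       = Round.found k x≈ (σ≡ k) A rα<d d≤α
      settled′ (ℕ.≤′-step k<n) = foldl-settled (σ _) (settled′ k<n)

      settled : ∀ {n} → suc k ℕ.≤ n → Settled (afterRounds σ x n) (e + u * slowPass (a ^ k) d)
      settled k<n = settled′ (ℕ.≤⇒≤′ k<n)

      partial≈E : ∀ n → suc k ℕ.≤ n → partial (afterRounds σ x n) ≈ E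
      partial≈E n k<n = trans (proj₂ (settled k<n)) ≈E

    -- Targets with distance above `a ^ j` and at most `a ^ (2 + j)` on the side of round `j`.

    module Target (j : ℕ) {x d} (x≈ : x ≈ side j * d) (α<d : a ^ j < d) where

      private
        α : Carrier
        α = a ^ j

      0<d : 0# < d
      0<d = <-trans (0<-^ j) α<d

      wrong-side : ∀ i → side j ≈ - side i → Missed x i
      wrong-side i opposite = - d ,
        trans x≈ (trans (*-congʳ opposite) (solve 2 (λ s d → :- s :* d := s :* :- d) refl (side i) d)) ,
        inj₁ (<-respʳ-≈ (solve 0 (:- 𝟘 := 𝟘) refl) (neg-mono-< 0<d))

      -- Round `j - 1` goes to the other side. An earlier round `i` on the same side has
      -- `2 + i ≤ j`, so its scouting ends within `a ^ j`, short of `d`.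
      missed-before : ∀ i → i ℕ.< j → Missed x i
      missed-before i i<j with ℕ.m≤n⇒m<n∨m≡n i<j
      ... | inj₂ ≡.refl = wrong-side i (side-suc i)
      ... | inj₁ 2+i≤j with same-or-opposite (side-sign j) (side-sign i)
      ...   | inj₂ opposite = wrong-side i opposite
      ...   | inj₁ same     = d , trans x≈ (*-congʳ same) ,
        inj₂ (≤-<-trans (≤-trans (wα≤a²α i) (^-monoʳ-≤ 2+i≤j)) α<d)

      missed-next : Missed x (suc j)
      missed-next = wrong-side (suc j) (sym (trans (-‿cong (side-suc j)) (solve 1 (λ s → :- (:- s) := s) refl (side j))))

      before : At (afterRounds σ x j) 0# (startTime α) 1# 0#
      before = all-missed j missed-before

      found-later : ∀ {u e E} → d ≤ a ^ (2 ℕ.+ j) →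
        At (afterRounds σ x (suc j)) 0# (startTime (a ^ suc j)) u e →
        e + u * (K * α + V * d - c₀) ≈ E → Expects x E
      found-later d≤ A ≈E = let z , x≈z , where? = missed-next in
        found⇒expects (2 ℕ.+ j) (trans x≈ (*-congʳ (sym (side-2+ j))))
          (<-respˡ-≈ (sym (ra²α≈α j)) α<d) d≤ (Round.missed (suc j) x≈z (σ≡ (suc j)) A where?)
          (trans (+-congˡ (*-congˡ (slowPass-2+ j))) ≈E)

      unscouted : w * α < d → d ≤ a ^ (2 ℕ.+ j) → Expects x (K * α + V * d - c₀)
      unscouted wα<d d≤ = found-later d≤ (Round.missed j x≈ (σ≡ j) before (inj₂ wα<d))
        (solve 1 (λ t → 𝟘 :+ 𝟙 :* t := t) refl _)

      -- The outward, the inward and the final slow pass are the first detection with probabilities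
      -- `p`, `(1 - p) p` and `(1 - p) ^ 2`. These sum to one, so `c₀` survives with coefficient
      -- one; collecting `α` and `d` gives `L` and `Q`.
      scouted : d < w * α → Expects x (L * α + Q * d - c₀)
      scouted d<wα = found-later (≤-trans (<⇒≤ d<wα) (wα≤a²α j))
        (Round.scouted j x≈ (σ≡ j) before α<d d<wα)
        (solve 8 (λ p w K M V α d c →
          let out = M :* α :+ (d :- α) :- c
              in′ = M :* α :+ (w :- 𝟙) :* α :- c :+ (w :* α :- d)
              L   = (𝟚 :* p :- p :^ 2) :* (M :- 𝟙) :+ 𝟚 :* w :* (p :* (𝟙 :- p)) :+ (𝟙 :- p) :^ 2 :* K
              Q   = p :^ 2 :+ (𝟙 :- p) :^ 2 :* V
          in (𝟘 :+ 𝟙 :* p :* out :+ 𝟙 :* (𝟙 :- p) :* p :* in′)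
               :+ 𝟙 :* (𝟙 :- p) :* (𝟙 :- p) :* (K :* α :+ V :* d :- c)
             := L :* α :+ Q :* d :- c)
          refl p w K M V α d c₀)

      scouted-once : d ≈ w * α → ∃[ E ] (Expects x E × E ≤ ρ₁ * d)
      scouted-once d≈wα = p * early + (1# - p) * late ,
        found-later (≤-trans (≤-reflexive d≈wα) (wα≤a²α j)) (Round.scouted-once j x≈ (σ≡ j) before α<d d≈wα)
          (solve 3 (λ p early late → (𝟘 :+ 𝟙 :* p :* early) :+ 𝟙 :* (𝟙 :- p) :* late
            := p :* early :+ (𝟙 :- p) :* late) refl p early late) ,
        ≤-trans (≤-by (*-nonNegative (<⇒≤ 0<p) (≤⇒0≤ (scout-before-slow (<⇒≤ (0<-^ j)) (<⇒≤ α<d))))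
                  (solve 3 (λ p early late → late := (p :* early :+ (𝟙 :- p) :* late) :+ p :* (late :- early))
                    refl p early late))
          (unscouted-bound (≤-reflexive (sym d≈wα)))
        where
        early late : Carrier
        early  = outPass α d
        late = K * α + V * d - c₀

    -- Upper bound for all admissible targets.

    ρ : Carrier
    ρ = ρ₁ ⊔ ρ₂

    ρ₁≤ρ : ρ₁ ≤ ρ
    ρ₁≤ρ = x≤x⊔y ρ₁ ρ₂

    ρ₂≤ρ : ρ₂ ≤ ρ
    ρ₂≤ρ = x≤y⊔x ρ₁ ρ₂

    Bounded : Carrier → Carrier → Set _
    Bounded x d = ∃[ E ] (Expects x E × E ≤ ρ * d)

    bounded-by : ∀ {x d E ρ′} → 0# < d → ρ′ ≤ ρ → Expects x E → E ≤ ρ′ * d → Bounded x d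
    bounded-by {x} {d} {E} {ρ′} 0<d ρ′≤ρ expects E≤ = E , expects ,
      ≤-trans E≤ (≤-by (*-nonNegative (≤⇒0≤ ρ′≤ρ) (<⇒≤ 0<d))
        (solve 3 (λ d ρ ρ′ → ρ :* d := ρ′ :* d :+ (ρ :- ρ′) :* d) refl d ρ ρ′))

    late-bounded : ∀ j {x d} → x ≈ side j * d → a ^ j < d → d ≤ a ^ (2 ℕ.+ j) → Bounded x d
    late-bounded j {x} {d} x≈ α<d d≤ with w * a ^ j <? d | d <? w * a ^ j
    ... | yes wα<d | _        = bounded-by 0<d ρ₁≤ρ (unscouted wα<d d≤) (unscouted-bound (<⇒≤ wα<d))
      where open Target j x≈ α<d
    ... | no  _    | yes d<wα = bounded-by 0<d ρ₂≤ρ (scouted d<wα) (scouted-bound (<⇒≤ α<d))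
      where open Target j x≈ α<d
    ... | no  wα≮d | no  d≮wα = let E , expects , E≤ = scouted-once (antisym (≮⇒≥ wα≮d) (≮⇒≥ d≮wα)) in
                                bounded-by 0<d ρ₁≤ρ expects E≤
      where open Target j x≈ α<d

    early-bounded : ∀ k {x d} → (∀ i → i ℕ.< k → Missed x i) →
                    x ≈ side k * d → d ≈ a ^ k → Bounded x d
    early-bounded k {x} {d} missed x≈ d≈α = bounded-by 0<d ρ₂≤ρ
      (found⇒expects k x≈ (<-respʳ-≈ (sym d≈α) (rα<α k)) (≤-reflexive d≈α) (all-missed k missed) (begin
        0# + 1# * slowPass (a ^ k) d     ≈⟨ solve 1 (λ t → 𝟘 :+ 𝟙 :* t := t) refl _ ⟩
        K * (r * a ^ k) + V * d - c₀     ≈⟨ +-congʳ (+-congʳ (*-congˡ (*-congˡ d≈α))) ⟨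
        K * (r * d) + V * d - c₀         ≈⟨ solve 5 (λ K V r d c → K :* (r :* d) :+ V :* d :- c := (K :* r :+ V) :* d :- c) refl K V r d c₀ ⟩
        M * d - c₀                       ∎))
      (first-visit-bound (<⇒≤ 0<d))
      where
      0<d : 0# < d
      0<d = <-respʳ-≈ (sym d≈α) (0<-^ k)

    -- The candidate rounds for a target on the side of round k are k, k + 2, ...
    bracket : ∀ k {d} m → d ≤ a ^ (m ℕ.* 2 ℕ.+ k) →
              (d ≤ a ^ k) ⊎ ∃[ j ] (side j ≈ side k × a ^ j < d × d ≤ a ^ (2 ℕ.+ j))
    bracket k     zero    d≤ = inj₁ d≤
    bracket k {d} (suc m) d≤ with d ≤? a ^ (m ℕ.* 2 ℕ.+ k)
    ... | yes d≤′ = bracket k m d≤′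
    ... | no  d≰  = inj₂ (m ℕ.* 2 ℕ.+ k , side≈ m , ≰⇒> d≰ , d≤)
      where
      side≈ : ∀ m → side (m ℕ.* 2 ℕ.+ k) ≈ side k
      side≈ zero    = refl
      side≈ (suc m) = trans (side-2+ (m ℕ.* 2 ℕ.+ k)) (side≈ m)

    bounded-from : ∀ k {x d} → (d ≤ a ^ k → ∀ i → i ℕ.< k → Missed x i) →
                   x ≈ side k * d → a ^ k ≤ d → Bounded x d
    bounded-from k {x} {d} missed x≈ α≤d = by-bracket (bracket k n (≤-trans (<⇒≤ d<aⁿ)
        -- The exponent `n` is enlarged to `n * 2 + k`, from which `bracket` descends in steps of
        -- two.
        (^-monoʳ-≤ (ℕ.≤-trans (ℕ.m≤m*n n 2) (ℕ.m≤m+n (n ℕ.* 2) k)))))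
      where
      n = proj₁ (powers-unbounded 1<a d)
      d<aⁿ = proj₂ (powers-unbounded 1<a d)

      by-bracket : (d ≤ a ^ k) ⊎ ∃[ j ] (side j ≈ side k × a ^ j < d × d ≤ a ^ (2 ℕ.+ j)) → Bounded x d
      by-bracket (inj₁ d≤α) = early-bounded k (missed d≤α) x≈ (antisym d≤α α≤d)
      by-bracket (inj₂ (j , side≈ , αⱼ<d , d≤)) =
        late-bounded j (trans x≈ (*-congʳ (sym side≈))) αⱼ<d d≤

    -- Negative targets belong to the even rounds, which begin with round 0 and `a ^ 0`, positive
    -- ones to the odd rounds, which begin with round 1 and `a ^ 1`. This is why `BeyondStart` has
    -- the ends `- 1#` and `a`.
    bounded : ∀ x → BeyondStart a x → 0# < ∣ x ∣ × Bounded x ∣ x ∣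
    bounded x (inj₁ x≤-1) = <-≤-trans 0<1 1≤∣x∣ ,
      bounded-from 0 (λ _ _ ()) (trans x≈ (*-congʳ (sym (*-identityʳ _)))) 1≤∣x∣
      where
      1≤-x : 1# ≤ - x
      1≤-x = ≤-respˡ-≈ (solve 0 (:- (:- 𝟙) := 𝟙) refl) (neg-mono-≤ x≤-1)

      ∣x∣≈-x : ∣ x ∣ ≈ - x
      ∣x∣≈-x = trans (sym (∣-x∣≈∣x∣ x)) (0≤x⇒∣x∣≈x (≤-trans 0≤1 1≤-x))

      1≤∣x∣ : 1# ≤ ∣ x ∣
      1≤∣x∣ = ≤-respʳ-≈ (sym ∣x∣≈-x) 1≤-x

      x≈ : x ≈ - 1# * ∣ x ∣
      x≈ = sym (trans (*-congˡ ∣x∣≈-x) (solve 1 (λ x → :- 𝟙 :* :- x := x) refl x))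
    bounded x (inj₂ a≤x) = <-≤-trans 0<a a≤∣x∣ ,
      bounded-from 1 (λ _ i i<1 → missed i i<1) x≈ (≤-respˡ-≈ (sym (*-identityʳ a)) a≤∣x∣)
      where
      0≤x : 0# ≤ x
      0≤x = ≤-trans (<⇒≤ 0<a) a≤x

      ∣x∣≈x : ∣ x ∣ ≈ x
      ∣x∣≈x = 0≤x⇒∣x∣≈x 0≤x

      a≤∣x∣ : a ≤ ∣ x ∣
      a≤∣x∣ = ≤-respʳ-≈ (sym ∣x∣≈x) a≤x

      x≈ : x ≈ side 1 * ∣ x ∣
      x≈ = sym (trans (*-congˡ ∣x∣≈x) (solve 1 (λ x → (:- 𝟙 :* (:- 𝟙 :* 𝟙)) :* x := x) refl x))

      missed : ∀ i → i ℕ.< 1 → Missed x i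
      missed zero _ = - x , solve 1 (λ x → x := (:- 𝟙 :* 𝟙) :* (:- x)) refl x ,
        inj₁ (<-respʳ-≈ (solve 0 (:- 𝟘 := 𝟘) refl) (neg-mono-< (<-≤-trans 0<a a≤x)))
      missed (suc i) (ℕ.s≤s ())

    -- Targets whose ratios exceed every smaller bound.

    beyond-start : ∀ j {d} → 1# < a ^ j → a ^ j < d → BeyondStart a (side j * d)
    beyond-start zero        1<1  _   = ⊥-elim (<-irrefl refl 1<1)
    beyond-start (suc j) {d} 1<α α<d with side-sign (suc j)
    ... | inj₂ s≈-1 = inj₁ (≤-respˡ-≈ (sym (-1*-≈ s≈-1)) (neg-mono-≤ (<⇒≤ (<-trans 1<α α<d))))
    -- The round index is positive here, so `a` is at most its power and hence below `d`.
    ... | inj₁ s≈1  = inj₂ (≤-respʳ-≈ (sym (1*-≈ s≈1))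
      (≤-trans (≤-respˡ-≈ (*-identityʳ a) (^-monoʳ-≤ (ℕ.s≤s (ℕ.z≤n {j})))) (<⇒≤ α<d)))

    Exceeded : Carrier → Set _
    Exceeded y = ∃[ t ] (ExpectedRatio σ (BeyondStart a) t × y < t)

    exceeded-at : ∀ j {d E y} → 1# < a ^ j → a ^ j < d → Expects (side j * d) E → y * d < E → Exceeded y
    exceeded-at j {d} {E} {y} 1<α α<d expects yd<E = E / ∣ side j * d ∣ ,
      (side j * d , E , beyond-start j 1<α α<d , proj₁ expects , refl) ,
      <-/ (<-respʳ-≈ (sym ∣x∣≈d) 0<d) (<-respˡ-≈ (*-congˡ (sym ∣x∣≈d)) yd<E)
      where
      0<d : 0# < d
      0<d = <-trans (<-trans 0<1 1<α) α<d

      ∣x∣≈d : ∣ side j * d ∣ ≈ d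
      ∣x∣≈d = trans (∣sign*-∣ (side-sign j)) (0≤x⇒∣x∣≈x (<⇒≤ 0<d))

    <ρ₁⇒exceeded : b < 1# → ∀ y → y < ρ₁ → Exceeded y
    <ρ₁⇒exceeded b<1 y y<ρ₁ = at-round (asymptotically-exceeded 0<θ)
      where
      δ : Carrier
      -- The target `w * a ^ j + δ` lies just beyond the scouting, as `b < 1#` makes `δ` positive.
      -- It stays within `a ^ (2 + j)`, because `(a ^ 2 - w) * (a ^ j - 1#)` is nonnegative.
      δ = a ^ 2 - w

      0<δ : 0# < δ
      0<δ = <-respʳ-≈ (solve 2 (λ a b → ((a :- 𝟙) :* (𝟙 :+ a)) :* (𝟙 :- b) := a :^ 2 :- ((a :^ 2 :- 𝟙) :* b :+ 𝟙)) refl a b)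
        (0<-* (0<-* (<⇒0< 1<a) (0<-+ 0<1 (<⇒≤ 0<a))) (<⇒0< b<1))

      0<θ : 0# < K + (V - y) * w
      -- The leading coefficient is `(ρ₁ - y) * w`.
      0<θ = <-respʳ-≈ (begin
        (ρ₁ - y) * w                               ≈⟨ *-congʳ (+-congʳ ρ₁≈) ⟩
        (K * W + V - y) * w                        ≈⟨ solve 5 (λ y w K W V → (K :* W :+ V :- y) :* w := (K :+ (V :- y) :* w) :+ K :* (w :* W :- 𝟙)) refl y w K W V ⟩
        (K + (V - y) * w) + K * (w * W - 1#)       ≈⟨ +-vanish K wW≈1 ⟩
        K + (V - y) * w                            ∎)
        (0<-* (<⇒0< y<ρ₁) 0<w)

      at-round : ∃[ j ] (1# < a ^ j × y * (w * a ^ j + δ) < K * a ^ j + V * (w * a ^ j + δ) - c₀) →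
                 Exceeded y
      at-round (j , 1<α , <E) = exceeded-at j 1<α α<d (Target.unscouted j refl α<d wα<d d≤a²α) <E
        where
        wα<d : w * a ^ j < w * a ^ j + δ
        wα<d = <-by 0<δ refl

        α<d : a ^ j < w * a ^ j + δ
        α<d = ≤-<-trans (≤-by (*-nonNegative (≤⇒0≤ 1≤w) (<⇒≤ (0<-^ j)))
          (solve 2 (λ w α → w :* α := α :+ (w :- 𝟙) :* α) refl w (a ^ j))) wα<d

        d≤a²α : w * a ^ j + δ ≤ a ^ (2 ℕ.+ j)
        d≤a²α = ≤-by (*-nonNegative (<⇒≤ 0<δ) (≤⇒0≤ (<⇒≤ 1<α)))
          (solve 3 (λ a w α → a :* (a :* α) := (w :* α :+ (a :^ 2 :- w)) :+ (a :^ 2 :- w) :* (α :- 𝟙))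
            refl a w (a ^ j))

    <ρ₂⇒exceeded : 0# < b → ∀ y → y < ρ₂ → Exceeded y
    <ρ₂⇒exceeded 0<b y y<ρ₂ = at-round (asymptotically-exceeded 0<θ)
      where
      δ : Carrier
      -- The target `a ^ j + δ` lies just beyond the slow leg, as `0# < b` makes `δ` positive. It is
      -- still scouted twice, because `(w - 1#) * (a ^ j - 1#)` is positive.
      δ = w - 1#

      0<δ : 0# < δ
      0<δ = <-respʳ-≈ (solve 2 (λ a b → ((a :- 𝟙) :* (𝟙 :+ a)) :* b := (a :^ 2 :- 𝟙) :* b :+ 𝟙 :- 𝟙) refl a b)
        (0<-* (0<-* (<⇒0< 1<a) (0<-+ 0<1 (<⇒≤ 0<a))) 0<b)

      0<θ : 0# < L + (Q - y) * 1#
      0<θ = <-respʳ-≈ (trans (+-congʳ ρ₂≈L+Q)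
          (solve 3 (λ y L Q → L :+ Q :- y := L :+ (Q :- y) :* 𝟙) refl y L Q))
        (<⇒0< y<ρ₂)

      at-round : ∃[ j ] (1# < a ^ j × y * (1# * a ^ j + δ) < L * a ^ j + Q * (1# * a ^ j + δ) - c₀) →
                 Exceeded y
      at-round (j , 1<α , <E) = exceeded-at j 1<α α<d (Target.scouted j refl α<d d<wα) <E
        where
        α<d : a ^ j < 1# * a ^ j + δ
        α<d = <-by 0<δ (+-congʳ (*-identityˡ _))

        d<wα : 1# * a ^ j + δ < w * a ^ j
        d<wα = <-by (0<-* 0<δ (<⇒0< 1<α))
          (solve 2 (λ w α → w :* α := (𝟙 :* α :+ (w :- 𝟙)) :+ (w :- 𝟙) :* (α :- 𝟙)) refl w (a ^ j))

    exceeded : ∀ y → y < ρ → Exceeded y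
    exceeded y y<ρ with b <? 1# | 0# <? b
    ... | no  b≮1 | _       = <ρ₂⇒exceeded (<-≤-trans 0<1 (≮⇒≥ b≮1)) y
      (<-≤-trans y<ρ (≤-reflexive (x≤y⇒x⊔y≈y (b≈1⇒ρ₁≤ρ₂ (antisym b≤1 (≮⇒≥ b≮1))))))
    ... | yes b<1 | no  0≮b = <ρ₁⇒exceeded b<1 y
      (<-≤-trans y<ρ (≤-reflexive (x≤y⇒y⊔x≈y (b≈0⇒ρ₂≤ρ₁ (antisym (≮⇒≥ 0≮b) 0≤b)))))
    ... | yes b<1 | yes 0<b with total ρ₁ ρ₂
    ...   | inj₁ ρ₁≤ρ₂ = <ρ₂⇒exceeded 0<b y (<-≤-trans y<ρ (≤-reflexive (x≤y⇒x⊔y≈y ρ₁≤ρ₂)))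
    ...   | inj₂ ρ₂≤ρ₁ = <ρ₁⇒exceeded b<1 y (<-≤-trans y<ρ (≤-reflexive (x≤y⇒y⊔x≈y ρ₂≤ρ₁)))

    -- The supremum.

    competitive-ratio : IsExpectedCompetitiveRatio σ (BeyondStart a) ρ
    competitive-ratio = finite , upper , exceeded
      where
      finite : ∀ x → BeyondStart a x → ∃ (HasExpectedTime σ x)
      finite x beyond = let _ , E , (hasExpectedTime , _) , _ = bounded x beyond in E , hasExpectedTime

      upper : UpperBound (ExpectedRatio σ (BeyondStart a)) ρ
      upper t (x , E′ , beyond , hasExpectedTime , t≈) =
        let 0<∣x∣ , E , (_ , unique) , E≤ = bounded x beyond in
        ≤-respˡ-≈ (sym t≈) (/-≤ 0<∣x∣ (≤-respˡ-≈ (unique E′ hasExpectedTime) E≤))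

theorem4 : ∀ {c ℓ₁ ℓ₂} (ℝ : RealNumbers c ℓ₁ ℓ₂) →
    let open RealNumbers ℝ in
    (p v a b : Carrier) →
    0# < p → p < 1# →
    0# < v → v < 1# →
    1# < a →
    0# ≤ b → b ≤ 1# →
    let open Search ℝ p v in
    IsExpectedCompetitiveRatio (algorithm a b) (BeyondStart a) (CR₁ a b ⊔ CR₂ a b)
theorem4 ℝ p v a b 0<p p<1 0<v v<1 1<a 0≤b b≤1 =
  Ratios.Play.competitive-ratio ℝ p v a b 0<p p<1 0<v v<1 1<a 0≤b b≤1
    (Search.algorithm ℝ p v a b) (λ _ → ≡.refl)
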